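{- The inverse calculus $\mathsf{IC}^{ax}_{G,H}$ yields an exponential-time decision procedure for satisfiability w.r.t. global axioms in $\mathsf{K}$. Precisely: consider the algorithm that, given $\mathsf{K}$-formulae $G,H$ in negation normal form, computes the closure $\mathcal{S}_0^{\vdash_{ax}}$ of the set of axioms $\mathcal{S}_0$ of $\mathsf{IC}^{ax}_{G,H}$ under $\vdash_{ax}$, and answers "not satisfiable" if $\{\emptyset,\{\epsilon_G\}\}\cap\mathcal{S}_0^{\vdash_{ax}}\neq\emptyset$ and "satisfiable" otherwise. Then this algorithm is correct, i.e. $G$ is satisfiable w.r.t. the global axiom $H$ if and only if $\{\emptyset,\{\epsilon_G\}\}\cap\mathcal{S}_0^{\vdash_{ax}}=\emptyset$, and it can be realized so as to run in time exponential in the size of $G$ and $H$ (i.e. time $2^{p(s)}$ for some polynomial $p$, where $s$ is the size of the input formulae).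
   Context: $\mathsf{K}$-formulae are built from propositional atoms with $\wedge,\vee,\neg,\Box,\Diamond$, with the usual Kripke semantics over models $\mathcal{M}=(W,R,V)$. $G$ is satisfiable w.r.t. the global axiom $H$ iff there are a Kripke model $\mathcal{M}=(W,R,V)$ and $w\in W$ with $\mathcal{M},w\models G$ and $\mathcal{M},w'\models H$ for all $w'\in W$. A formula is in negation normal form (NNF) if $\neg$ occurs only in front of atoms; every $\mathsf{K}$-formula can be transformed in linear time into an equivalent formula in NNF. $(G,H)$-paths: $\Pi_{G,H}$ is the smallest subset of $\{\epsilon_G,\epsilon_H\}\cdot\{\vee_l,\vee_r,\wedge_l,\wedge_r,\Box,\Diamond\}^*$, with addressed subformulae $(G,H)|_\pi$, such that: $\epsilon_G,\epsilon_H\in\Pi_{G,H}$, $(G,H)|_{\epsilon_G}=G$, $(G,H)|_{\epsilon_H}=H$; if $\pi\in\Pi_{G,H}$ and $(G,H)|_\pi=F_1\wedge F_2$ then $\pi\wedge_l,\pi\wedge_r\in\Pi_{G,H}$, addressing $F_1$, $F_2$ respectively ($\wedge$-path); if $(G,H)|_\pi=F_1\vee F_2$ then $\pi\vee_l,\pi\vee_r\in\Pi_{G,H}$, addressing $F_1$, $F_2$ respectively ($\vee$-path); if $(G,H)|_\pi=\Box F$ then $\pi\Box\in\Pi_{G,H}$ addresses $F$ ($\Box$-path); if $(G,H)|_\pi=\Diamond F$ then $\pi\Diamond\in\Pi_{G,H}$ addresses $F$ ($\Diamond$-path). Inverse calculus $\mathsf{IC}^{ax}_{G,H}$: a sequent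 is a subset of $\Pi_{G,H}$; $\Gamma,\Lambda$ denotes union and $\Gamma,\pi$ denotes $\Gamma\cup\{\pi\}$; for a set $\Gamma$ of $\Box$-paths, $\Gamma\Box=\{\pi\Box\mid\pi\in\Gamma\}$. Axioms are all sequents $\{\pi_1,\pi_2\}$ with $(G,H)|_{\pi_1}=p$, $(G,H)|_{\pi_2}=\neg p$ for some propositional variable $p$; $\mathcal{S}_0$ is the set of axioms. Rules (all paths in $\Pi_{G,H}$): $(\vee)$ from $\Gamma_l,\pi\vee_l$ and $\Gamma_r,\pi\vee_r$ infer $\Gamma_l,\Gamma_r,\pi$; $(\wedge_l)$ from $\Gamma,\pi\wedge_l$ infer $\Gamma,\pi$; $(\wedge_r)$ from $\Gamma,\pi\wedge_r$ infer $\Gamma,\pi$; $(\Diamond)$ from $\Gamma\Box,\pi\Diamond$ infer $\Gamma,\pi$; $(\Diamond^+)$ from $\Gamma\Box$ infer $\Gamma,\pi$ for a $\Diamond$-path $\pi$ (in the last two rules $\Gamma$ consists only of $\Box$-paths); $(ax)$ from $\Gamma,\epsilon_H$ infer $\Gamma$. $\mathcal{S}\vdash_{ax}\mathcal{T}$ iff $\mathcal{T}=\mathcal{S}\cup\{\Gamma\}$ where $\Gamma$ is the conclusion of an inference with premises in $\mathcal{S}$; $\vdash_{ax}^*$ is the reflexive-transitive closure; $\mathcal{S}_0^{\vdash_{ax}}=\bigcup\{\mathcal{S}\mid\mathcal{S}_0\vdash_{ax}^*\mathcal{S}\}$. -}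

module Defs where

open import Level using (0ℓ)
open import Data.Fin using (Fin)
open import Data.List using (List; []; _∷_; [_]; foldr; map; _++_)
open import Data.List.Relation.Binary.BagAndSetEquality using (_∼[_]_; set)
open import Data.List.Relation.Unary.Any using (Any)
open import Data.Nat using (ℕ; zero; suc; _+_; _*_; _≤_)
open import Data.Nat.Binary using (ℕᵇ; 2[1+_]; 1+[2_])
import Data.Nat.Binary as ℕᵇ
open import Data.Product using (Σ; ∃; ∃-syntax; _×_; _,_)
open import Data.Sum using (_⊎_)
open import Data.Vec using (Vec; []; _∷_; lookup)
open import Function.Bundles using (_⇔_)
open import Relation.Binary.Core using (Rel)
open import Relation.Binary.Construct.Closure.ReflexiveTransitive using (Star)
open import Relation.Nullary using (¬_)
open import Relation.Unary using (Pred; _∪_; _∩_; _≐_; Empty; Satisfiable)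

infixr 7 _∧_
infixr 6 _∨_
infix  8 ∼_ □_ ◇_

-- The propositional variables are p₀, p₁, p₂, …, with indices written
-- in binary.

data Formula : Set where
  atom    : ℕᵇ → Formula
  ∼_      : Formula → Formula
  _∧_ _∨_ : Formula → Formula → Formula
  □_ ◇_   : Formula → Formula

-- The number of symbols.  An atom is not a single symbol: its index
-- must be counted, since infinitely many atoms are available and a
-- machine has to read the index.

size : Formula → ℕ
size (atom p) = suc (ℕᵇ.size p)
size (∼ F)    = suc (size F)
size (F ∧ G)  = suc (size F + size G)
size (F ∨ G)  = suc (size F + size G)
size (□ F)    = suc (size F)
size (◇ F)    = suc (size F)

data NNF : Formula → Set where
  pos  : ∀ {p} → NNF (atom p)
  neg  : ∀ {p} → NNF (∼ atom p)
  _∧_  : ∀ {F G} → NNF F → NNF G → NNF (F ∧ G)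
  _∨_  : ∀ {F G} → NNF F → NNF G → NNF (F ∨ G)
  □_   : ∀ {F} → NNF F → NNF (□ F)
  ◇_   : ∀ {F} → NNF F → NNF (◇ F)

record Model : Set₁ where
  field
    W : Set
    R : Rel W 0ℓ
    V : ℕᵇ → Pred W 0ℓ

infix 4 _,_⊨_

_,_⊨_ : (ℳ : Model) → Model.W ℳ → Formula → Set
ℳ , w ⊨ atom p = Model.V ℳ p w
ℳ , w ⊨ ∼ F    = ¬ (ℳ , w ⊨ F)
ℳ , w ⊨ F ∧ G  = (ℳ , w ⊨ F) × (ℳ , w ⊨ G)
ℳ , w ⊨ F ∨ G  = (ℳ , w ⊨ F) ⊎ (ℳ , w ⊨ G)
ℳ , w ⊨ □ F    = ∀ v → Model.R ℳ w v → ℳ , v ⊨ F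
ℳ , w ⊨ ◇ F    = ∃[ v ] (Model.R ℳ w v × (ℳ , v ⊨ F))

SatisfiableWrt : (G H : Formula) → Set₁
SatisfiableWrt G H =
  Σ Model λ ℳ → ∃[ w ] ((ℳ , w ⊨ G) × (∀ w′ → ℳ , w′ ⊨ H))

module Calculus (G H : Formula) where

  infixl 9 _∧l _∧r _∨l _∨r _□ _◇

  -- Path F consists of the (G,H)-paths π with (G,H)|π = F.  So
  -- Path (F₁ ∧ F₂), Path (F₁ ∨ F₂), Path (□ F) and Path (◇ F) consist
  -- of ∧-, ∨-, □- and ◇-paths, respectively.

  data Path : Formula → Set where
    εG  : Path G
    εH  : Path H
    _∧l : ∀ {F₁ F₂} → Path (F₁ ∧ F₂) → Path F₁
    _∧r : ∀ {F₁ F₂} → Path (F₁ ∧ F₂) → Path F₂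
    _∨l : ∀ {F₁ F₂} → Path (F₁ ∨ F₂) → Path F₁
    _∨r : ∀ {F₁ F₂} → Path (F₁ ∨ F₂) → Path F₂
    _□  : ∀ {F} → Path (□ F) → Path F
    _◇  : ∀ {F} → Path (◇ F) → Path F

  Π : Set
  Π = ∃ Path

  ⟪_⟫ : ∀ {F} → Path F → Π
  ⟪ π ⟫ = _ , π

  -- Π is finite, so its subsets are represented by lists, taken up to
  -- having the same members.

  Sequent : Set
  Sequent = List Π

  infix 4 _≈_

  _≈_ : Rel Sequent 0ℓ
  Γ ≈ Δ = Γ ∼[ set ] Δ

  □-Paths : Set
  □-Paths = List (∃[ F ] Path (□ F))

  forget : □-Paths → Sequent
  forget = map λ (_ , π) → ⟪ π ⟫

  infixl 9 _·□

  _·□ : □-Paths → Sequent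
  Γ ·□ = map (λ (_ , π) → ⟪ π □ ⟫) Γ

  -- A set of sequents is a predicate invariant under ≈.  The set 𝒮₀
  -- is one, and ⊢ax preserves this property; therefore the rules below
  -- need not mention ≈.

  𝒮₀ : Pred Sequent 0ℓ
  𝒮₀ Γ = ∃[ p ] Σ (Path (atom p)) λ π₁ → Σ (Path (∼ atom p)) λ π₂ →
         Γ ≈ ⟪ π₁ ⟫ ∷ ⟪ π₂ ⟫ ∷ []

  -- Inference 𝒮 Γ: Γ is the conclusion of an inference with premises
  -- in 𝒮.

  data Inference (𝒮 : Pred Sequent 0ℓ) : Pred Sequent 0ℓ where
    ∨-rule  : ∀ {F₁ F₂} (π : Path (F₁ ∨ F₂)) (Γₗ Γᵣ : Sequent) →
              𝒮 (⟪ π ∨l ⟫ ∷ Γₗ) → 𝒮 (⟪ π ∨r ⟫ ∷ Γᵣ) →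
              Inference 𝒮 (⟪ π ⟫ ∷ Γₗ ++ Γᵣ)
    ∧l-rule : ∀ {F₁ F₂} (π : Path (F₁ ∧ F₂)) (Γ : Sequent) →
              𝒮 (⟪ π ∧l ⟫ ∷ Γ) → Inference 𝒮 (⟪ π ⟫ ∷ Γ)
    ∧r-rule : ∀ {F₁ F₂} (π : Path (F₁ ∧ F₂)) (Γ : Sequent) →
              𝒮 (⟪ π ∧r ⟫ ∷ Γ) → Inference 𝒮 (⟪ π ⟫ ∷ Γ)
    ◇-rule  : ∀ {F} (π : Path (◇ F)) (Γ : □-Paths) →
              𝒮 (⟪ π ◇ ⟫ ∷ Γ ·□) → Inference 𝒮 (⟪ π ⟫ ∷ forget Γ)
    ◇⁺-rule : ∀ {F} (π : Path (◇ F)) (Γ : □-Paths) →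
              𝒮 (Γ ·□) → Inference 𝒮 (⟪ π ⟫ ∷ forget Γ)
    ax-rule : (Γ : Sequent) → 𝒮 (⟪ εH ⟫ ∷ Γ) → Inference 𝒮 Γ

  infix 4 _⊢ax_ _⊢ax*_

  _⊢ax_ : Rel (Pred Sequent 0ℓ) 0ℓ
  𝒮 ⊢ax 𝒯 = ∃[ Γ ] (Inference 𝒮 Γ × 𝒯 ≐ 𝒮 ∪ (_≈ Γ))

  _⊢ax*_ : Rel (Pred Sequent 0ℓ) _
  _⊢ax*_ = Star _⊢ax_

  𝒮₀⊢ax : Pred Sequent _
  𝒮₀⊢ax Γ = ∃[ 𝒮 ] (𝒮₀ ⊢ax* 𝒮 × 𝒮 Γ)

  Refutations : Pred Sequent 0ℓ
  Refutations = (_≈ []) ∪ (_≈ [ ⟪ εG ⟫ ])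

-- Programs are systems of mutually recursive first-order functions
-- over S-expressions with call-by-value evaluation, where each
-- evaluation step has unit cost; see N. D. Jones, "Computability and
-- Complexity from a Programming Perspective".  Trees can be shared, and
-- the only test on trees, nil or not, inspects the root, so one step is
-- a constant number of pointer operations.  Time in this model is
-- polynomially related to time on Turing machines, hence bounds of the
-- form 2^p(s) are the same in both models.

infixr 6 _∙_

data Tree : Set where
  nil : Tree
  _∙_ : Tree → Tree → Tree

module _ {k : ℕ} (arity : Fin k → ℕ) where

  -- Expr n: expressions over n variables.  In match e e₁ e₂, e₁ is
  -- evaluated if e yields nil; if e yields x ∙ y, then e₂ is evaluated
  -- with x as variable 0 and y as variable 1.

  data Expr (n : ℕ) : Set where
    var   : Fin n → Expr n
    nil   : Expr n
    cons  : Expr n → Expr n → Expr n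
    match : Expr n → Expr n → Expr (2 + n) → Expr n
    let′  : Expr n → Expr (1 + n) → Expr n
    call  : (f : Fin k) → Vec (Expr n) (arity f) → Expr n

record Program (inputs : ℕ) : Set where
  field
    functions : ℕ
    arity     : Fin functions → ℕ
    body      : (f : Fin functions) → Expr arity (arity f)
    main      : Expr arity inputs

module Evaluation {i : ℕ} (P : Program i) where
  open Program P

  infix 4 _⊢_⇓_⟨_⟩ _⊢_⇓*_⟨_⟩

  -- ρ ⊢ e ⇓ v ⟨ t ⟩: in the environment ρ, e evaluates to v in t steps.

  mutual
    data _⊢_⇓_⟨_⟩ {n : ℕ} (ρ : Vec Tree n) :
                  Expr arity n → Tree → ℕ → Set where
      var        : ∀ x → ρ ⊢ var x ⇓ lookup ρ x ⟨ 1 ⟩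
      nil        : ρ ⊢ nil ⇓ nil ⟨ 1 ⟩
      cons       : ∀ {e₁ e₂ v₁ v₂ s t} →
                   ρ ⊢ e₁ ⇓ v₁ ⟨ s ⟩ → ρ ⊢ e₂ ⇓ v₂ ⟨ t ⟩ →
                   ρ ⊢ cons e₁ e₂ ⇓ v₁ ∙ v₂ ⟨ suc (s + t) ⟩
      match-nil  : ∀ {e e₁ e₂ v s t} →
                   ρ ⊢ e ⇓ nil ⟨ s ⟩ → ρ ⊢ e₁ ⇓ v ⟨ t ⟩ →
                   ρ ⊢ match e e₁ e₂ ⇓ v ⟨ suc (s + t) ⟩
      match-cons : ∀ {e e₁ e₂ x y v s t} →
                   ρ ⊢ e ⇓ x ∙ y ⟨ s ⟩ → x ∷ y ∷ ρ ⊢ e₂ ⇓ v ⟨ t ⟩ →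
                   ρ ⊢ match e e₁ e₂ ⇓ v ⟨ suc (s + t) ⟩
      let′       : ∀ {e₁ e₂ u v s t} →
                   ρ ⊢ e₁ ⇓ u ⟨ s ⟩ → u ∷ ρ ⊢ e₂ ⇓ v ⟨ t ⟩ →
                   ρ ⊢ let′ e₁ e₂ ⇓ v ⟨ suc (s + t) ⟩
      call       : ∀ {f es vs v s t} →
                   ρ ⊢ es ⇓* vs ⟨ s ⟩ → vs ⊢ body f ⇓ v ⟨ t ⟩ →
                   ρ ⊢ call f es ⇓ v ⟨ suc (s + t) ⟩

    data _⊢_⇓*_⟨_⟩ {n : ℕ} (ρ : Vec Tree n) :
                   ∀ {m} → Vec (Expr arity n) m → Vec Tree m → ℕ → Set where
      []  : ρ ⊢ [] ⇓* [] ⟨ 0 ⟩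
      _∷_ : ∀ {m e v s t} {es : Vec (Expr arity n) m} {vs : Vec Tree m} →
            ρ ⊢ e ⇓ v ⟨ s ⟩ → ρ ⊢ es ⇓* vs ⟨ t ⟩ →
            ρ ⊢ e ∷ es ⇓* v ∷ vs ⟨ s + t ⟩

Runs : ∀ {i} → Program i → Vec Tree i → Tree → ℕ → Set
Runs P inputs output t = inputs ⊢ Program.main P ⇓ output ⟨ t ⟩
  where open Evaluation P

tag : ℕ → Tree
tag zero    = nil
tag (suc n) = nil ∙ tag n

encodeList : ∀ {A : Set} → (A → Tree) → List A → Tree
encodeList encode = foldr (λ x t → encode x ∙ t) nil

encodeIndex : ℕᵇ → Tree
encodeIndex ℕᵇ.zero  = nil
encodeIndex 2[1+ p ] = tag 0 ∙ encodeIndex p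
encodeIndex 1+[2 p ] = tag 1 ∙ encodeIndex p

encodeFormula : Formula → Tree
encodeFormula (atom p) = tag 0 ∙ encodeIndex p
encodeFormula (∼ F)    = tag 1 ∙ encodeFormula F
encodeFormula (F ∧ G)  = tag 2 ∙ encodeFormula F ∙ encodeFormula G
encodeFormula (F ∨ G)  = tag 3 ∙ encodeFormula F ∙ encodeFormula G
encodeFormula (□ F)    = tag 4 ∙ encodeFormula F
encodeFormula (◇ F)    = tag 5 ∙ encodeFormula F

module _ {G H : Formula} where
  open Calculus G H

  encodePath : ∀ {F} → Path F → Tree
  encodePath εG     = tag 0 ∙ nil
  encodePath εH     = tag 1 ∙ nil
  encodePath (π ∧l) = tag 2 ∙ encodePath π
  encodePath (π ∧r) = tag 3 ∙ encodePath π
  encodePath (π ∨l) = tag 4 ∙ encodePath π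
  encodePath (π ∨r) = tag 5 ∙ encodePath π
  encodePath (π □)  = tag 6 ∙ encodePath π
  encodePath (π ◇)  = tag 7 ∙ encodePath π

  encodeSequent : Sequent → Tree
  encodeSequent = encodeList λ (_ , π) → encodePath π

data Answer : Set where
  satisfiable not-satisfiable : Answer

encodeAnswer : Answer → Tree
encodeAnswer satisfiable     = tag 0
encodeAnswer not-satisfiable = tag 1

module _ (G H : Formula) where
  open Calculus G H

  data Answers : Answer → Set₁ where
    hit  : ∃⟨ Refutations ∩ 𝒮₀⊢ax ⟩ → Answers not-satisfiable
    miss : Empty (Refutations ∩ 𝒮₀⊢ax) → Answers satisfiable

  _Enumerates-𝒮₀⊢ax : List Sequent → Set₁
  Γs Enumerates-𝒮₀⊢ax = ∀ Γ → 𝒮₀⊢ax Γ ⇔ Any (Γ ≈_) Γs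

  -- The computed closure is part of the output, so that a program with
  -- this property has to carry out the closure computation and not
  -- merely decide satisfiability.

  record RealizedBy (P : Program 2) (bound : ℕ) : Set₁ where
    field
      closure    : List Sequent
      answer     : Answer
      time       : ℕ
      enumerates : closure Enumerates-𝒮₀⊢ax
      answers    : Answers answer
      runs       : Runs P (encodeFormula G ∷ encodeFormula H ∷ [])
                     (encodeAnswer answer ∙ encodeList encodeSequent closure)
                     time
      in-time    : time ≤ bound

-- A polynomial is given by its coefficients, constant term first.

Polynomial : Set
Polynomial = List ℕ

eval : Polynomial → ℕ → ℕ
eval p s = foldr (λ a r → a + s * r) 0 p

{-# OPTIONS --safe #-}
module Submission where

-- Correctness.  No world of a model of the global axiom satisfies all
-- paths of a derivable sequent.  Conversely, call a set of paths refuted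
-- if it includes a derivable sequent.  The maximal sets of paths that are
-- not refuted are the worlds of a model in which each world satisfies all
-- formulae addressed by its paths; the rules are just what this needs.  If
-- neither ∅ nor {ε_G} is derivable, then some world contains ε_G.
--
-- Complexity.  There are at most s paths, where s = size G + size H, so up
-- to having the same members there are at most 2 ^ s sequents, namely the
-- subsequences of a list of all paths.  The closure is reached by 2 ^ s
-- rounds of S ↦ { Γ | Γ is an axiom or follows by one inference from S },
-- where each Γ is tested against all pairs of premises in S.  With
-- K = B ^ 3 and B = 2 ^ (8 + s), a loop of fewer than B iterations, each of
-- which calls functions running in time K ^ ℓ, runs in time K ^ (1 + ℓ);
-- the loops are nested so that the program runs in time K ^ 12.

open import Defs
open import Data.Bool using (Bool; true; false; T)
import Data.Bool as Bool
open import Data.Empty using (⊥)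
open import Data.Fin using (Fin; zero; suc)
open import Data.Fin.Patterns
import Data.Fin.Properties as Fin
open import Data.List using (List; []; _∷_; [_]; map; _++_; length; filter; mapMaybe)
open import Data.List.Membership.Propositional using (_∈_; _∉_)
open import Data.List.Membership.Propositional.Properties
  using (∈-map⁺; ∈-map⁻; ∈-++⁺ˡ; ∈-++⁺ʳ; ∈-++⁻; ∈-filter⁺; ∈-filter⁻)
open import Data.List.Properties using (length-map; length-++; length-filter; length-mapMaybe)
open import Data.List.Relation.Binary.Pointwise using (Pointwise-≡⇒≡)
open import Data.List.Relation.Binary.Sublist.Heterogeneous.Properties
  using (⊆-filter-Sublist; length-mono-≤; toPointwise)
open import Data.List.Relation.Binary.Sublist.Propositional using (minimum) renaming (_⊆_ to _≼_)
import Data.List.Relation.Binary.Sublist.Propositional as Sublist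
open import Data.List.Relation.Binary.Subset.Propositional using (_⊆_)
open import Data.List.Relation.Binary.Subset.Propositional.Properties
  using (Any-resp-⊆; ⊆∷∧∉⇒⊆; ∷⁺ʳ) renaming (∈-∷⁺ʳ to ∈-∷⊆; map⁺ to map-⊆)
open import Data.List.Relation.Unary.All as All using (All; []; _∷_)
import Data.List.Relation.Unary.All.Properties as All
open import Data.List.Relation.Unary.Any as Any using (Any; here; there)
open import Data.Maybe using (Maybe; just; nothing)
open import Data.Nat
open import Data.Nat.Binary using (2[1+_]; 1+[2_])
import Data.Nat.Binary as ℕᵇ
open import Data.Nat.Properties
open import Data.Product using (Σ; ∃-syntax; _×_; _,_; proj₁; proj₂; uncurry)
open import Data.Sum as Sum using (_⊎_; inj₁; inj₂; [_,_]′)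
open import Data.Unit using (⊤)
open import Data.Vec using (Vec; []; _∷_; lookup)
open import Function.Base using (_∘_; id; _∋_)
open import Function.Bundles using (_⇔_; mk⇔; Equivalence)
open import Level using (0ℓ)
open import Relation.Binary.Construct.Closure.ReflexiveTransitive using (ε; _◅_; _◅◅_)
open import Relation.Binary.PropositionalEquality hiding ([_])
open import Relation.Nullary using (¬_; Dec; yes; no; contradiction)
open import Relation.Nullary.Decidable
  using (does; map′; _×-dec_; _⊎-dec_; decidable-stable; toWitness)
open import Relation.Unary using (Pred; Decidable; Empty; _∩_; _∪_)
open import Algebra.Properties.CommutativeSemigroup +-commutativeSemigroup
  using () renaming (interchange to +-interchange)

open Equivalence using (to; from)

-- Subsequences, saturation and paths

-- The calculus has no weakening, so a premise is not derivable merely because some subset of it is.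
-- The arguments about models therefore deal with supersets of derivable sequents, and (◇⁺) serves
-- the case in which the derivable subset lacks the path below ◇. Maximal sets and the case
-- distinction at ∨ call for deciding whether a set is refuted; constructively this is a search of
-- the saturated list. That list is also what the program outputs, and the Boolean of that decision
-- is its answer, so completeness and program rest on one construction. Testing given candidates
-- instead of producing conclusions keeps every stage inside a fixed list: the program never forms
-- the union of two contexts, and the length of a stage measures progress. Each function of the
-- program mirrors a decision procedure or a list function, so that agreement of values is mostly a
-- matter of computation and the work lies in the cost.

module _ {A : Set} where

  subsequences : List A → List (List A)
  subsequences []       = [ [] ]
  subsequences (x ∷ xs) = map (x ∷_) (subsequences xs) ++ subsequences xs

  length-subsequences : ∀ xs → length (subsequences xs) ≡ 2 ^ length xs
  length-subsequences []       = refl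
  length-subsequences (x ∷ xs) = begin
    length (map (x ∷_) ys ++ ys)         ≡⟨ length-++ (map (x ∷_) ys) ⟩
    length (map (x ∷_) ys) + length ys   ≡⟨ cong (_+ length ys) (length-map (x ∷_) ys) ⟩
    length ys + length ys                ≡⟨ cong (λ n → n + n) (length-subsequences xs) ⟩
    2 ^ length xs + 2 ^ length xs        ≡⟨ cong (2 ^ length xs +_) (+-identityʳ _) ⟨
    2 ^ length (x ∷ xs)                  ∎
    where
    open ≡-Reasoning
    ys = subsequences xs

  subsequences-length-≤ : ∀ xs → All (λ ys → length ys ≤ length xs) (subsequences xs)
  subsequences-length-≤ []       = z≤n ∷ []
  subsequences-length-≤ (x ∷ xs) = All.++⁺ (All.map⁺ (All.map s≤s ih)) (All.map m≤n⇒m≤1+n ih)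
    where ih = subsequences-length-≤ xs

  filter-∈-subsequences : ∀ {P : Pred A 0ℓ} (P? : Decidable P) xs →
                          filter P? xs ∈ subsequences xs
  filter-∈-subsequences P? []       = here refl
  filter-∈-subsequences P? (x ∷ xs) with P? x
  ... | yes _ = ∈-++⁺ˡ (∈-map⁺ (x ∷_) (filter-∈-subsequences P? xs))
  ... | no _  = ∈-++⁺ʳ (map (x ∷_) (subsequences xs)) (filter-∈-subsequences P? xs)

-- Only the length of the argument of stage matters: it is the number of
-- rounds.

module Saturation
  {A : Set} {P : List A → Pred A 0ℓ} (P? : ∀ S → Decidable (P S))
  (mono : ∀ {S T x} → S ⊆ T → P S x → P T x)
  (universe : List A)
  where

  step : List A → List A
  step S = filter (P? S) universe

  stage : List A → List A
  stage []      = []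
  stage (_ ∷ c) = step (stage c)

  saturation : List A
  saturation = stage universe

  -- Both sides filter the same list, so the inclusion respects order and multiplicity. Hence equal
  -- lengths force equal lists, which is how a repeated stage is recognised.
  step-mono : ∀ {S T} → S ⊆ T → step S ≼ step T
  step-mono {S} {T} S⊆T =
    ⊆-filter-Sublist (P? S) (P? T) (λ { refl → mono S⊆T }) (Sublist.⊆-refl {x = universe})

  stage-increasing : ∀ c → stage c ≼ step (stage c)
  stage-increasing []      = minimum _
  stage-increasing (_ ∷ c) = step-mono (Sublist.lookup (stage-increasing c))

  -- A round that changes the list lengthens it by at least one, and after a round that changes
  -- nothing every later round changes nothing either.
  stage-grows : ∀ c → step (stage c) ≡ stage c ⊎ length c < length (step (stage c))
  stage-grows []      with step []
  ... | []    = inj₁ refl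
  ... | _ ∷ _ = inj₂ z<s
  stage-grows (x ∷ c) with stage-grows c
  ... | inj₁ eq = inj₁ (cong step eq)
  ... | inj₂ lt with m≤n⇒m<n∨m≡n (length-mono-≤ (stage-increasing (x ∷ c)))
  ...   | inj₁ lt′ = inj₂ (≤-<-trans lt lt′)
  ...   | inj₂ eq  =
    inj₁ (sym (Pointwise-≡⇒≡ (toPointwise eq (stage-increasing (x ∷ c)))))

  step-saturation : step saturation ≡ saturation
  step-saturation with stage-grows universe
  ... | inj₁ eq = eq
  -- Otherwise the next stage, a filter of `universe`, would be longer than `universe`.
  ... | inj₂ lt = contradiction lt (≤⇒≯ (length-filter (P? saturation) universe))

  ∈-saturation⁺ : ∀ {x} → x ∈ universe → P saturation x → x ∈ saturation
  ∈-saturation⁺ x∈ px =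
    subst (_ ∈_) step-saturation (∈-filter⁺ (P? saturation) x∈ px)

  stage-induction : (Q : Pred A 0ℓ) → (∀ {S x} → All Q S → P S x → Q x) → ∀ c → All Q (stage c)
  stage-induction Q ind []      = []
  stage-induction Q ind (_ ∷ c) =
    All.map (ind (stage-induction Q ind c)) (All.all-filter (P? (stage c)) universe)

-- Trees and injectivity of the encodings

∙-injective : ∀ {t u t′ u′} → t ∙ u ≡ t′ ∙ u′ → t ≡ t′ × u ≡ u′
∙-injective refl = refl , refl

infix 4 _≟ᵀ_

_≟ᵀ_ : (t u : Tree) → Dec (t ≡ u)
nil     ≟ᵀ nil       = yes refl
nil     ≟ᵀ (_ ∙ _)   = no λ ()
(_ ∙ _) ≟ᵀ nil       = no λ ()
(t ∙ u) ≟ᵀ (t′ ∙ u′) =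
  map′ (uncurry (cong₂ _∙_)) ∙-injective (t ≟ᵀ t′ ×-dec u ≟ᵀ u′)

nodes : Tree → ℕ
nodes nil     = 1
nodes (t ∙ u) = suc (nodes t + nodes u)

encodeIndex-injective : ∀ p q → encodeIndex p ≡ encodeIndex q → p ≡ q
encodeIndex-injective ℕᵇ.zero  ℕᵇ.zero  eq = refl
encodeIndex-injective 2[1+ p ] 2[1+ q ] eq =
  cong 2[1+_] (encodeIndex-injective p q (proj₂ (∙-injective eq)))
encodeIndex-injective 1+[2 p ] 1+[2 q ] eq =
  cong 1+[2_] (encodeIndex-injective p q (proj₂ (∙-injective eq)))

encodeFormula-injective : ∀ F F′ → encodeFormula F ≡ encodeFormula F′ → F ≡ F′
encodeFormula-injective (atom p) (atom q) eq =
  cong atom (encodeIndex-injective p q (proj₂ (∙-injective eq)))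
encodeFormula-injective (∼ F) (∼ F′) eq =
  cong ∼_ (encodeFormula-injective F F′ (proj₂ (∙-injective eq)))
encodeFormula-injective (F₁ ∧ F₂) (F₁′ ∧ F₂′) eq =
  let eq₁ , eq₂ = ∙-injective (proj₂ (∙-injective eq)) in
  cong₂ _∧_ (encodeFormula-injective F₁ F₁′ eq₁) (encodeFormula-injective F₂ F₂′ eq₂)
encodeFormula-injective (F₁ ∨ F₂) (F₁′ ∨ F₂′) eq =
  let eq₁ , eq₂ = ∙-injective (proj₂ (∙-injective eq)) in
  cong₂ _∨_ (encodeFormula-injective F₁ F₁′ eq₁) (encodeFormula-injective F₂ F₂′ eq₂)
encodeFormula-injective (□ F) (□ F′) eq =
  cong □_ (encodeFormula-injective F F′ (proj₂ (∙-injective eq)))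
encodeFormula-injective (◇ F) (◇ F′) eq =
  cong ◇_ (encodeFormula-injective F F′ (proj₂ (∙-injective eq)))

module Paths (G H : Formula) where
  open Calculus G H

  encode : Π → Tree
  encode (_ , π) = encodePath π

  -- An address determines the formula that it addresses, so the formula indices need not be
  -- compared: equality in `Π` is equality of trees, which the program can test.
  encodePath-injective : ∀ {F F′} (π : Path F) (σ : Path F′) →
                         encodePath π ≡ encodePath σ → ⟪ π ⟫ ≡ ⟪ σ ⟫
  encodePath-injective εG εG eq = refl
  encodePath-injective εH εH eq = refl
  encodePath-injective (π ∧l) (σ ∧l) eq
    with refl ← encodePath-injective π σ (proj₂ (∙-injective eq)) = refl
  encodePath-injective (π ∧r) (σ ∧r) eq
    with refl ← encodePath-injective π σ (proj₂ (∙-injective eq)) = refl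
  encodePath-injective (π ∨l) (σ ∨l) eq
    with refl ← encodePath-injective π σ (proj₂ (∙-injective eq)) = refl
  encodePath-injective (π ∨r) (σ ∨r) eq
    with refl ← encodePath-injective π σ (proj₂ (∙-injective eq)) = refl
  encodePath-injective (π □) (σ □) eq
    with refl ← encodePath-injective π σ (proj₂ (∙-injective eq)) = refl
  encodePath-injective (π ◇) (σ ◇) eq
    with refl ← encodePath-injective π σ (proj₂ (∙-injective eq)) = refl

  infix 4 _≟Π_ _∈?_

  _≟Π_ : (x y : Π) → Dec (x ≡ y)
  x ≟Π y = map′ (encodePath-injective (proj₂ x) (proj₂ y)) (cong encode) (encode x ≟ᵀ encode y)

  _∈?_ : (x : Π) (Γ : Sequent) → Dec (x ∈ Γ)
  x ∈? Γ = Any.any? (x ≟Π_) Γ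

  NNF-path : NNF G → NNF H → ∀ {F} → Path F → NNF F
  NNF-path g h εG = g
  NNF-path g h εH = h
  NNF-path g h (π ∧l) with f ∧ _ ← NNF-path g h π = f
  NNF-path g h (π ∧r) with _ ∧ f ← NNF-path g h π = f
  NNF-path g h (π ∨l) with f ∨ _ ← NNF-path g h π = f
  NNF-path g h (π ∨r) with _ ∨ f ← NNF-path g h π = f
  NNF-path g h (π □)  with □ f ← NNF-path g h π = f
  NNF-path g h (π ◇)  with ◇ f ← NNF-path g h π = f

  -- The accumulator spares the program an append at each binary connective. No path leads below
  -- `∼`, so its clause is that of a leaf.
  collect : ∀ F → Path F → List Π → List Π
  collect (atom p)  π xs = ⟪ π ⟫ ∷ xs
  collect (∼ F)     π xs = ⟪ π ⟫ ∷ xs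
  collect (F₁ ∧ F₂) π xs = ⟪ π ⟫ ∷ collect F₁ (π ∧l) (collect F₂ (π ∧r) xs)
  collect (F₁ ∨ F₂) π xs = ⟪ π ⟫ ∷ collect F₁ (π ∨l) (collect F₂ (π ∨r) xs)
  collect (□ F)     π xs = ⟪ π ⟫ ∷ collect F (π □) xs
  collect (◇ F)     π xs = ⟪ π ⟫ ∷ collect F (π ◇) xs

  paths : List Π
  paths = collect G εG (collect H εH [])

  length-collect : ∀ F (π : Path F) xs → length (collect F π xs) ≤ size F + length xs
  length-collect₂ : ∀ F₁ F₂ (π₁ : Path F₁) (π₂ : Path F₂) xs →
                    length (collect F₁ π₁ (collect F₂ π₂ xs)) ≤ size F₁ + size F₂ + length xs

  length-collect (atom p)  π xs = s≤s (m≤n+m _ _)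
  length-collect (∼ F)     π xs = s≤s (m≤n+m _ _)
  length-collect (F₁ ∧ F₂) π xs = s≤s (length-collect₂ F₁ F₂ _ _ xs)
  length-collect (F₁ ∨ F₂) π xs = s≤s (length-collect₂ F₁ F₂ _ _ xs)
  length-collect (□ F)     π xs = s≤s (length-collect F _ xs)
  length-collect (◇ F)     π xs = s≤s (length-collect F _ xs)

  length-collect₂ F₁ F₂ π₁ π₂ xs = begin
    length (collect F₁ π₁ (collect F₂ π₂ xs)) ≤⟨ length-collect F₁ π₁ _ ⟩
    size F₁ + length (collect F₂ π₂ xs)       ≤⟨ +-monoʳ-≤ (size F₁) (length-collect F₂ π₂ xs) ⟩
    size F₁ + (size F₂ + length xs)           ≡⟨ +-assoc (size F₁) _ _ ⟨
    size F₁ + size F₂ + length xs             ∎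
    where open ≤-Reasoning

  length-paths : length paths ≤ size G + size H
  length-paths = subst (length paths ≤_) (+-identityʳ _) (length-collect₂ G H εG εH [])

  infix 4 _⋖_

  data _⋖_ : Π → Π → Set where
    ∧ˡ : ∀ {F₁ F₂} (π : Path (F₁ ∧ F₂)) → ⟪ π ∧l ⟫ ⋖ ⟪ π ⟫
    ∧ʳ : ∀ {F₁ F₂} (π : Path (F₁ ∧ F₂)) → ⟪ π ∧r ⟫ ⋖ ⟪ π ⟫
    ∨ˡ : ∀ {F₁ F₂} (π : Path (F₁ ∨ F₂)) → ⟪ π ∨l ⟫ ⋖ ⟪ π ⟫
    ∨ʳ : ∀ {F₁ F₂} (π : Path (F₁ ∨ F₂)) → ⟪ π ∨r ⟫ ⋖ ⟪ π ⟫
    □ᶜ : ∀ {F} (π : Path (□ F)) → ⟪ π □ ⟫ ⋖ ⟪ π ⟫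
    ◇ᶜ : ∀ {F} (π : Path (◇ F)) → ⟪ π ◇ ⟫ ⋖ ⟪ π ⟫

  -- `collect` recurses on the formula, whereas a path grows at its lower end. Closure under
  -- children lets `∈-paths` proceed by induction on the path.
  ChildClosed : Pred (List Π) 0ℓ
  ChildClosed xs = ∀ {x y} → x ⋖ y → y ∈ xs → x ∈ xs

  collect-⊇ : ∀ F (π : Path F) xs → xs ⊆ collect F π xs
  collect-⊇ (atom p)  π xs = there
  collect-⊇ (∼ F)     π xs = there
  collect-⊇ (F₁ ∧ F₂) π xs = there ∘ collect-⊇ F₁ _ _ ∘ collect-⊇ F₂ _ _
  collect-⊇ (F₁ ∨ F₂) π xs = there ∘ collect-⊇ F₁ _ _ ∘ collect-⊇ F₂ _ _
  collect-⊇ (□ F)     π xs = there ∘ collect-⊇ F _ _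
  collect-⊇ (◇ F)     π xs = there ∘ collect-⊇ F _ _

  collect-∋ : ∀ F (π : Path F) xs → ⟪ π ⟫ ∈ collect F π xs
  collect-∋ (atom p)  π xs = here refl
  collect-∋ (∼ F)     π xs = here refl
  collect-∋ (F₁ ∧ F₂) π xs = here refl
  collect-∋ (F₁ ∨ F₂) π xs = here refl
  collect-∋ (□ F)     π xs = here refl
  collect-∋ (◇ F)     π xs = here refl

  ∷-childClosed : ∀ {y xs} → ChildClosed xs → (∀ {x} → x ⋖ y → x ∈ xs) → ChildClosed (y ∷ xs)
  ∷-childClosed closed children x⋖y (here refl) = there (children x⋖y)
  ∷-childClosed closed children x⋖y (there y∈)  = there (closed x⋖y y∈)

  collect-childClosed : ∀ F (π : Path F) {xs} → ChildClosed xs → ChildClosed (collect F π xs)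
  collect-childClosed (atom p) π closed = ∷-childClosed closed λ ()
  collect-childClosed (∼ F)    π closed = ∷-childClosed closed λ ()
  collect-childClosed (F₁ ∧ F₂) π closed =
    ∷-childClosed (collect-childClosed F₁ _ (collect-childClosed F₂ _ closed)) λ
      { (∧ˡ .π) → collect-∋ F₁ _ _
      ; (∧ʳ .π) → collect-⊇ F₁ _ _ (collect-∋ F₂ _ _) }
  collect-childClosed (F₁ ∨ F₂) π closed =
    ∷-childClosed (collect-childClosed F₁ _ (collect-childClosed F₂ _ closed)) λ
      { (∨ˡ .π) → collect-∋ F₁ _ _
      ; (∨ʳ .π) → collect-⊇ F₁ _ _ (collect-∋ F₂ _ _) }
  collect-childClosed (□ F) π closed =
    ∷-childClosed (collect-childClosed F _ closed) λ { (□ᶜ .π) → collect-∋ F _ _ }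
  collect-childClosed (◇ F) π closed =
    ∷-childClosed (collect-childClosed F _ closed) λ { (◇ᶜ .π) → collect-∋ F _ _ }

  paths-childClosed : ChildClosed paths
  paths-childClosed = collect-childClosed G εG (collect-childClosed H εH λ _ ())

  ∈-paths : ∀ {F} (π : Path F) → ⟪ π ⟫ ∈ paths
  ∈-paths εG     = collect-∋ G εG _
  ∈-paths εH     = collect-⊇ G εG _ (collect-∋ H εH _)
  ∈-paths (π ∧l) = paths-childClosed (∧ˡ π) (∈-paths π)
  ∈-paths (π ∧r) = paths-childClosed (∧ʳ π) (∈-paths π)
  ∈-paths (π ∨l) = paths-childClosed (∨ˡ π) (∈-paths π)
  ∈-paths (π ∨r) = paths-childClosed (∨ʳ π) (∈-paths π)
  ∈-paths (π □)  = paths-childClosed (□ᶜ π) (∈-paths π)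
  ∈-paths (π ◇)  = paths-childClosed (◇ᶜ π) (∈-paths π)

-- Derivability

module Derivations (G H : Formula) where
  open Calculus G H
  open Paths G H

  ⊆-antisym : ∀ {Γ Δ : Sequent} → Γ ⊆ Δ → Δ ⊆ Γ → Γ ≈ Δ
  ⊆-antisym Γ⊆Δ Δ⊆Γ = mk⇔ Γ⊆Δ Δ⊆Γ

  ≈⇒⊆ : ∀ {Γ Δ} → Γ ≈ Δ → Γ ⊆ Δ
  ≈⇒⊆ Γ≈Δ = to Γ≈Δ

  ≈⇒⊇ : ∀ {Γ Δ} → Γ ≈ Δ → Δ ⊆ Γ
  ≈⇒⊇ Γ≈Δ = from Γ≈Δ

  ≈-refl : ∀ {Γ} → Γ ≈ Γ
  ≈-refl = ⊆-antisym id id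

  ≈-sym : ∀ {Γ Δ} → Γ ≈ Δ → Δ ≈ Γ
  ≈-sym Γ≈Δ = ⊆-antisym (≈⇒⊇ Γ≈Δ) (≈⇒⊆ Γ≈Δ)

  ≈-trans : ∀ {Γ Δ Θ} → Γ ≈ Δ → Δ ≈ Θ → Γ ≈ Θ
  ≈-trans Γ≈Δ Δ≈Θ = ⊆-antisym (≈⇒⊆ Δ≈Θ ∘ ≈⇒⊆ Γ≈Δ) (≈⇒⊇ Γ≈Δ ∘ ≈⇒⊇ Δ≈Θ)

  -- The tree form of `𝒮₀⊢ax`, suited to induction. The step `Γ ≈ Δ` reflects that `⊢ax` adds a
  -- conclusion together with all lists that have the same members.
  data Derivable : Pred Sequent 0ℓ where
    axiom : ∀ {Γ} → 𝒮₀ Γ → Derivable Γ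
    infer : ∀ {Γ Δ} → Inference Derivable Δ → Γ ≈ Δ → Derivable Γ

  Derivable-resp-≈ : ∀ {Γ Δ} → Γ ≈ Δ → Derivable Γ → Derivable Δ
  Derivable-resp-≈ Γ≈Δ (axiom (p , π₁ , π₂ , eq)) =
    axiom (p , π₁ , π₂ , ≈-trans (≈-sym Γ≈Δ) eq)
  Derivable-resp-≈ Γ≈Δ (infer inf eq) = infer inf (≈-trans (≈-sym Γ≈Δ) eq)

  Inference-mono : ∀ {𝒮 𝒯 : Pred Sequent 0ℓ} → (∀ {Γ} → 𝒮 Γ → 𝒯 Γ) →
                   ∀ {Γ} → Inference 𝒮 Γ → Inference 𝒯 Γ
  Inference-mono f (∨-rule π Γₗ Γᵣ l r) = ∨-rule π Γₗ Γᵣ (f l) (f r)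
  Inference-mono f (∧l-rule π Γ d)      = ∧l-rule π Γ (f d)
  Inference-mono f (∧r-rule π Γ d)      = ∧r-rule π Γ (f d)
  Inference-mono f (◇-rule π Γ d)       = ◇-rule π Γ (f d)
  Inference-mono f (◇⁺-rule π Γ d)      = ◇⁺-rule π Γ (f d)
  Inference-mono f (ax-rule Γ d)        = ax-rule Γ (f d)

  ⊢ax*-derivable : ∀ {𝒮 𝒯} → 𝒮 ⊢ax* 𝒯 → (∀ {Γ} → 𝒮 Γ → Derivable Γ) → ∀ {Γ} → 𝒯 Γ → Derivable Γ
  ⊢ax*-derivable ε sound = sound
  ⊢ax*-derivable ((Δ , inf , 𝒯⊆ , _) ◅ steps) sound = ⊢ax*-derivable steps λ t →
    [ sound , infer (Inference-mono sound inf) ]′ (𝒯⊆ t)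

  𝒮₀⊢ax⇒Derivable : ∀ {Γ} → 𝒮₀⊢ax Γ → Derivable Γ
  𝒮₀⊢ax⇒Derivable (𝒮 , steps , s) = ⊢ax*-derivable steps axiom s

  ⊢ax-snoc : ∀ {𝒮 Γ} → 𝒮₀ ⊢ax* 𝒮 → Inference 𝒮 Γ → 𝒮₀ ⊢ax* (𝒮 ∪ (_≈ Γ))
  ⊢ax-snoc steps inf = steps ◅◅ (_ , inf , id , id) ◅ ε

  -- Two derivations from 𝒮₀ are merged by replaying the second one on top
  -- of the first.
  ⊢ax*-merge : ∀ {𝒮 𝒯 𝒯′} → 𝒮₀ ⊢ax* 𝒮 → (∀ {Γ} → 𝒯 Γ → 𝒮 Γ) → 𝒯 ⊢ax* 𝒯′ →
               ∃[ 𝒮′ ] (𝒮₀ ⊢ax* 𝒮′ × (∀ {Γ} → 𝒮 Γ → 𝒮′ Γ) × (∀ {Γ} → 𝒯′ Γ → 𝒮′ Γ))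
  ⊢ax*-merge steps 𝒯⊆𝒮 ε = _ , steps , id , 𝒯⊆𝒮
  ⊢ax*-merge steps 𝒯⊆𝒮 ((Δ , inf , ⊆∪ , _) ◅ steps′) =
    let 𝒮′ , steps″ , ⊆₁ , ⊆₂ =
          ⊢ax*-merge (⊢ax-snoc steps (Inference-mono 𝒯⊆𝒮 inf)) (Sum.map₁ 𝒯⊆𝒮 ∘ ⊆∪) steps′
    in 𝒮′ , steps″ , ⊆₁ ∘ inj₁ , ⊆₂

  𝒮₀⊢ax-infer : ∀ {𝒮 Γ Δ} → 𝒮₀ ⊢ax* 𝒮 → Inference 𝒮 Δ → Γ ≈ Δ → 𝒮₀⊢ax Γ
  𝒮₀⊢ax-infer steps inf Γ≈Δ = _ , ⊢ax-snoc steps inf , inj₂ (λ {x} → Γ≈Δ {x})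

  Derivable⇒𝒮₀⊢ax : ∀ {Γ} → Derivable Γ → 𝒮₀⊢ax Γ
  Derivable⇒𝒮₀⊢ax (axiom a) = 𝒮₀ , ε , a
  -- Each premise comes with a chain of its own, but the inference needs one set that contains both.
  Derivable⇒𝒮₀⊢ax (infer (∨-rule π Γₗ Γᵣ l r) eq) =
    let _ , steps₁ , s₁          = Derivable⇒𝒮₀⊢ax l
        _ , steps₂ , s₂          = Derivable⇒𝒮₀⊢ax r
        _ , steps  , emb₁ , emb₂ = ⊢ax*-merge ε id steps₁
        _ , steps′ , emb₃ , emb₄ = ⊢ax*-merge steps₁ (𝒮₀⊆ steps₁) steps₂
    in 𝒮₀⊢ax-infer steps′ (∨-rule π Γₗ Γᵣ (emb₃ s₁) (emb₄ s₂)) eq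
    where
    𝒮₀⊆ : ∀ {𝒮 𝒯} → 𝒮 ⊢ax* 𝒯 → ∀ {Γ} → 𝒮 Γ → 𝒯 Γ
    𝒮₀⊆ ε                              s = s
    𝒮₀⊆ ((_ , _ , _ , ∪⊆) ◅ steps) s = 𝒮₀⊆ steps (∪⊆ (inj₁ s))
  Derivable⇒𝒮₀⊢ax (infer (∧l-rule π Γ d) eq) =
    let _ , steps , s = Derivable⇒𝒮₀⊢ax d in 𝒮₀⊢ax-infer steps (∧l-rule π Γ s) eq
  Derivable⇒𝒮₀⊢ax (infer (∧r-rule π Γ d) eq) =
    let _ , steps , s = Derivable⇒𝒮₀⊢ax d in 𝒮₀⊢ax-infer steps (∧r-rule π Γ s) eq
  Derivable⇒𝒮₀⊢ax (infer (◇-rule π Γ d) eq) =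
    let _ , steps , s = Derivable⇒𝒮₀⊢ax d in 𝒮₀⊢ax-infer steps (◇-rule π Γ s) eq
  Derivable⇒𝒮₀⊢ax (infer (◇⁺-rule π Γ d) eq) =
    let _ , steps , s = Derivable⇒𝒮₀⊢ax d in 𝒮₀⊢ax-infer steps (◇⁺-rule π Γ s) eq
  Derivable⇒𝒮₀⊢ax (infer (ax-rule Γ d) eq) =
    let _ , steps , s = Derivable⇒𝒮₀⊢ax d in 𝒮₀⊢ax-infer steps (ax-rule Γ s) eq

  -- The largest union in the tests below has three parts; smaller ones fill up with `[]`. The
  -- elementwise form lets the program check the inclusion without building the union.
  Covered : (Γ Δ₁ Δ₂ Δ₃ : Sequent) → Set
  Covered Γ Δ₁ Δ₂ Δ₃ = All (λ x → x ∈ Δ₁ ⊎ x ∈ Δ₂ ⊎ x ∈ Δ₃) Γ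

  covered? : ∀ Γ Δ₁ Δ₂ Δ₃ → Dec (Covered Γ Δ₁ Δ₂ Δ₃)
  covered? Γ Δ₁ Δ₂ Δ₃ = All.all? (λ x → x ∈? Δ₁ ⊎-dec x ∈? Δ₂ ⊎-dec x ∈? Δ₃) Γ

  Covered₁⁻ : ∀ {Γ Δ} → Covered Γ Δ [] [] → Γ ⊆ Δ
  Covered₁⁻ c x∈ with All.lookup c x∈
  ... | inj₁ x∈Δ = x∈Δ
  ... | inj₂ (inj₁ ())
  ... | inj₂ (inj₂ ())

  Covered₁⁺ : ∀ {Γ Δ} → Γ ⊆ Δ → Covered Γ Δ [] []
  Covered₁⁺ Γ⊆Δ = All.tabulate (inj₁ ∘ Γ⊆Δ)

  Covered₂⁻ : ∀ {Γ Δ₁ Δ₂} → Covered Γ Δ₁ Δ₂ [] → Γ ⊆ Δ₁ ++ Δ₂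
  Covered₂⁻ {Δ₁ = Δ₁} c x∈ with All.lookup c x∈
  ... | inj₁ x∈Δ₁        = ∈-++⁺ˡ x∈Δ₁
  ... | inj₂ (inj₁ x∈Δ₂) = ∈-++⁺ʳ Δ₁ x∈Δ₂

  Covered₂⁺ : ∀ {Γ Δ₁ Δ₂} → Γ ⊆ Δ₁ ++ Δ₂ → Covered Γ Δ₁ Δ₂ []
  Covered₂⁺ {Δ₁ = Δ₁} Γ⊆ = All.tabulate (Sum.map₂ inj₁ ∘ ∈-++⁻ Δ₁ ∘ Γ⊆)

  -- Branching [ a ] [ a′ ] [ b ] X Y Γ holds iff X ≈ Γₗ , a and Y ≈ Γᵣ , a′
  -- and Γ ≈ Γₗ , Γᵣ , b for some Γₗ and Γᵣ, for which X ∩ Γ and Y ∩ Γ can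
  -- be taken.
  Branching : (A A′ B X Y Γ : Sequent) → Set
  Branching A A′ B X Y Γ =
    Covered A X [] [] × Covered X A Γ [] ×
    Covered A′ Y [] [] × Covered Y A′ Γ [] ×
    Covered B Γ [] [] × Covered Γ B X Y

  branching? : ∀ A A′ B X Y Γ → Dec (Branching A A′ B X Y Γ)
  branching? A A′ B X Y Γ =
    covered? A X [] [] ×-dec covered? X A Γ [] ×-dec
    covered? A′ Y [] [] ×-dec covered? Y A′ Γ [] ×-dec
    covered? B Γ [] [] ×-dec covered? Γ B X Y

  infixl 6 _∩′_

  _∩′_ : Sequent → Sequent → Sequent
  X ∩′ Γ = filter (_∈? Γ) X

  ∩′-⊆ˡ : ∀ X Γ → X ∩′ Γ ⊆ X
  ∩′-⊆ˡ X Γ = proj₁ ∘ ∈-filter⁻ (_∈? Γ)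

  ∩′-⊆ʳ : ∀ X Γ → X ∩′ Γ ⊆ Γ
  ∩′-⊆ʳ X Γ = proj₂ ∘ ∈-filter⁻ (_∈? Γ) {xs = X}

  ++-lub : ∀ Γ {Δ Θ : Sequent} → Γ ⊆ Θ → Δ ⊆ Θ → Γ ++ Δ ⊆ Θ
  ++-lub Γ Γ⊆Θ Δ⊆Θ = [ Γ⊆Θ , Δ⊆Θ ]′ ∘ ∈-++⁻ Γ

  premise-≈ : ∀ {A X} Γ → Covered A X [] [] → Covered X A Γ [] → X ≈ A ++ X ∩′ Γ
  premise-≈ {A} {X} Γ A⊆X X⊆ = ⊆-antisym fwd (++-lub A (Covered₁⁻ A⊆X) (∩′-⊆ˡ X Γ))
    where
    fwd : X ⊆ A ++ X ∩′ Γ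
    fwd x∈X with ∈-++⁻ A (Covered₂⁻ X⊆ x∈X)
    ... | inj₁ x∈A = ∈-++⁺ˡ x∈A
    ... | inj₂ x∈Γ = ∈-++⁺ʳ A (∈-filter⁺ (_∈? Γ) x∈X x∈Γ)

  conclusion-≈ : ∀ {B X Y Γ} → Covered B Γ [] [] → Covered Γ B X Y →
                 Γ ≈ B ++ X ∩′ Γ ++ Y ∩′ Γ
  conclusion-≈ {B} {X} {Y} {Γ} B⊆Γ Γ⊆ =
    ⊆-antisym fwd (++-lub B (Covered₁⁻ B⊆Γ) (++-lub (X ∩′ Γ) (∩′-⊆ʳ X Γ) (∩′-⊆ʳ Y Γ)))
    where
    fwd : Γ ⊆ B ++ X ∩′ Γ ++ Y ∩′ Γ
    fwd x∈Γ with All.lookup Γ⊆ x∈Γ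
    ... | inj₁ x∈B        = ∈-++⁺ˡ x∈B
    ... | inj₂ (inj₁ x∈X) = ∈-++⁺ʳ B (∈-++⁺ˡ (∈-filter⁺ (_∈? Γ) x∈X x∈Γ))
    ... | inj₂ (inj₂ x∈Y) = ∈-++⁺ʳ B (∈-++⁺ʳ (X ∩′ Γ) (∈-filter⁺ (_∈? Γ) x∈Y x∈Γ))

  -- A rule with one premise is treated as a branching one whose two premises coincide; its context
  -- then occurs twice.
  ++-diag : ∀ B Γ → B ++ Γ ++ Γ ≈ B ++ Γ
  ++-diag B Γ = ⊆-antisym
    (++-lub B ∈-++⁺ˡ (++-lub Γ (∈-++⁺ʳ B) (∈-++⁺ʳ B)))
    (++-lub B ∈-++⁺ˡ (∈-++⁺ʳ B ∘ ∈-++⁺ˡ))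

  branching⁻ : ∀ {A A′ B X Y Γ} → Branching A A′ B X Y Γ →
               ∃[ Γₗ ] ∃[ Γᵣ ] (X ≈ A ++ Γₗ × Y ≈ A′ ++ Γᵣ × Γ ≈ B ++ Γₗ ++ Γᵣ)
  branching⁻ {Γ = Γ} (c₁ , c₂ , c₃ , c₄ , c₅ , c₆) =
    _ , _ , premise-≈ Γ c₁ c₂ , premise-≈ Γ c₃ c₄ , conclusion-≈ c₅ c₆

  linear⁻ : ∀ {A B X Γ} → Branching A A B X X Γ → ∃[ Γ′ ] (X ≈ A ++ Γ′ × Γ ≈ B ++ Γ′)
  linear⁻ {B = B} {X} {Γ} (c₁ , c₂ , c₃ , c₄ , c₅ , c₆) =
    _ , premise-≈ Γ c₁ c₂ , ≈-trans (conclusion-≈ c₅ c₆) (++-diag B (X ∩′ Γ))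

  branching⁺ : ∀ {A A′ B X Y Γ Γₗ Γᵣ} →
               X ≈ A ++ Γₗ → Y ≈ A′ ++ Γᵣ → Γ ≈ B ++ Γₗ ++ Γᵣ → Branching A A′ B X Y Γ
  branching⁺ {A} {A′} {B} {X} {Y} {Γ} {Γₗ} {Γᵣ} X≈ Y≈ Γ≈ =
    Covered₁⁺ (≈⇒⊇ X≈ ∘ ∈-++⁺ˡ) ,
    Covered₂⁺ (++-lub A ∈-++⁺ˡ (∈-++⁺ʳ A ∘ ≈⇒⊇ Γ≈ ∘ ∈-++⁺ʳ B ∘ ∈-++⁺ˡ) ∘ ≈⇒⊆ X≈) ,
    Covered₁⁺ (≈⇒⊇ Y≈ ∘ ∈-++⁺ˡ) ,
    Covered₂⁺ (++-lub A′ ∈-++⁺ˡ (∈-++⁺ʳ A′ ∘ ≈⇒⊇ Γ≈ ∘ ∈-++⁺ʳ B ∘ ∈-++⁺ʳ Γₗ) ∘ ≈⇒⊆ Y≈) ,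
    Covered₁⁺ (≈⇒⊇ Γ≈ ∘ ∈-++⁺ˡ) ,
    All.tabulate (cover ∘ ≈⇒⊆ Γ≈)
    where
    cover : ∀ {x} → x ∈ B ++ Γₗ ++ Γᵣ → x ∈ B ⊎ x ∈ X ⊎ x ∈ Y
    cover = Sum.map₂ (Sum.map (≈⇒⊇ X≈ ∘ ∈-++⁺ʳ A) (≈⇒⊇ Y≈ ∘ ∈-++⁺ʳ A′) ∘ ∈-++⁻ Γₗ) ∘ ∈-++⁻ B

  linear⁺ : ∀ {A B X Γ Γ′} → X ≈ A ++ Γ′ → Γ ≈ B ++ Γ′ → Branching A A B X X Γ
  linear⁺ {A} {B} {Γ′ = Γ′} X≈ Γ≈ =
    branching⁺ {A} {A} {B} X≈ X≈ (≈-trans Γ≈ (≈-sym (++-diag B Γ′)))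

  parent : Π → Maybe (∃[ F ] Path (□ F))
  parent (_ , π □) = just (_ , π)
  parent _         = nothing

  unbox : Sequent → □-Paths
  unbox = mapMaybe parent

  unbox⁻ : ∀ X → unbox X ·□ ⊆ X
  unbox⁻ ((_ , εG) ∷ X)   x∈         = there (unbox⁻ X x∈)
  unbox⁻ ((_ , εH) ∷ X)   x∈         = there (unbox⁻ X x∈)
  unbox⁻ ((_ , π ∧l) ∷ X) x∈         = there (unbox⁻ X x∈)
  unbox⁻ ((_ , π ∧r) ∷ X) x∈         = there (unbox⁻ X x∈)
  unbox⁻ ((_ , π ∨l) ∷ X) x∈         = there (unbox⁻ X x∈)
  unbox⁻ ((_ , π ∨r) ∷ X) x∈         = there (unbox⁻ X x∈)
  unbox⁻ ((_ , π ◇) ∷ X)  x∈         = there (unbox⁻ X x∈)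
  unbox⁻ ((_ , π □) ∷ X)  (here eq)  = here eq
  unbox⁻ ((_ , π □) ∷ X)  (there x∈) = there (unbox⁻ X x∈)

  unbox⁺ : ∀ X {F} {π : Path (□ F)} → ⟪ π □ ⟫ ∈ X → (F , π) ∈ unbox X
  unbox⁺ (_ ∷ X)          (here refl) = here refl
  unbox⁺ ((_ , εG) ∷ X)   (there x∈)  = unbox⁺ X x∈
  unbox⁺ ((_ , εH) ∷ X)   (there x∈)  = unbox⁺ X x∈
  unbox⁺ ((_ , π ∧l) ∷ X) (there x∈)  = unbox⁺ X x∈
  unbox⁺ ((_ , π ∧r) ∷ X) (there x∈)  = unbox⁺ X x∈
  unbox⁺ ((_ , π ∨l) ∷ X) (there x∈)  = unbox⁺ X x∈
  unbox⁺ ((_ , π ∨r) ∷ X) (there x∈)  = unbox⁺ X x∈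
  unbox⁺ ((_ , π ◇) ∷ X)  (there x∈)  = unbox⁺ X x∈
  unbox⁺ ((_ , π □) ∷ X)  (there x∈)  = there (unbox⁺ X x∈)

  -- For `A` empty or a single path ending in ◇, the context of a modal inference can be read off
  -- the premise: it consists of the parents of the members that end in □. So no intersection with
  -- `Γ` has to be taken, in contrast to `Branching`.
  Modal : (A : Sequent) (b : Π) (X Γ : Sequent) → Set
  Modal A b X Γ =
    Covered A X [] [] × Covered X A (unbox X ·□) [] ×
    Covered [ b ] Γ [] [] × Covered (forget (unbox X)) Γ [] [] ×
    Covered Γ [ b ] (forget (unbox X)) []

  modal? : ∀ A b X Γ → Dec (Modal A b X Γ)
  modal? A b X Γ =
    covered? A X [] [] ×-dec covered? X A (unbox X ·□) [] ×-dec
    covered? [ b ] Γ [] [] ×-dec covered? (forget (unbox X)) Γ [] [] ×-dec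
    covered? Γ [ b ] (forget (unbox X)) []

  modal⁻ : ∀ {A b X Γ} → Modal A b X Γ →
           X ≈ A ++ unbox X ·□ × Γ ≈ b ∷ forget (unbox X)
  modal⁻ {A} {b} {X} (c₁ , c₂ , c₃ , c₄ , c₅) =
    ⊆-antisym (Covered₂⁻ c₂) (++-lub A (Covered₁⁻ c₁) (unbox⁻ X)) ,
    ⊆-antisym (Covered₂⁻ c₅) (++-lub [ b ] (Covered₁⁻ c₃) (Covered₁⁻ c₄))

  -- By the hypothesis on `A`, every member of `X` that ends in □ stems from `Γ′ ·□`, whence
  -- `unbox X` and `Γ′` have the same members.
  modal⁺ : ∀ {A b X Γ} (Γ′ : □-Paths) → (∀ {F} (π : Path (□ F)) → ⟪ π □ ⟫ ∉ A) →
           X ≈ A ++ Γ′ ·□ → Γ ≈ b ∷ forget Γ′ → Modal A b X Γ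
  modal⁺ {A} {b} {X} {Γ} Γ′ ∉A X≈ Γ≈ =
    Covered₁⁺ (≈⇒⊇ X≈ ∘ ∈-++⁺ˡ) ,
    Covered₂⁺ (++-lub A ∈-++⁺ˡ (∈-++⁺ʳ A ∘ map-⊆ _ Γ′⊆unbox) ∘ ≈⇒⊆ X≈) ,
    Covered₁⁺ (≈⇒⊇ Γ≈ ∘ ∈-++⁺ˡ) ,
    Covered₁⁺ (≈⇒⊇ Γ≈ ∘ there ∘ map-⊆ _ unbox⊆Γ′) ,
    Covered₂⁺ (++-lub [ b ] ∈-++⁺ˡ (there ∘ map-⊆ _ Γ′⊆unbox) ∘ ≈⇒⊆ Γ≈)
    where
    Γ′⊆unbox : Γ′ ⊆ unbox X
    Γ′⊆unbox π∈ = unbox⁺ X (≈⇒⊇ X≈ (∈-++⁺ʳ A (∈-map⁺ _ π∈)))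
    unbox⊆Γ′ : unbox X ⊆ Γ′
    unbox⊆Γ′ {_ , π} π∈ with ∈-++⁻ A (≈⇒⊆ X≈ (unbox⁻ X (∈-map⁺ _ π∈)))
    ... | inj₁ π□∈A = contradiction π□∈A (∉A π)
    ... | inj₂ π□∈Γ′ with _ , σ∈ , refl ← ∈-map⁻ _ π□∈Γ′ = σ∈

  -- One-step derivability of Γ from X and Y, where the principal path of
  -- the (left) premise is given; for (◇⁺) this is the path below the
  -- introduced ◇-path.
  Rule : ∀ {F} → Path F → (X Y Γ : Sequent) → Set
  Rule εG     X Y Γ = ⊥
  Rule εH     X Y Γ = Branching [ ⟪ εH ⟫ ] [ ⟪ εH ⟫ ] [] X X Γ
  Rule (π ∧l) X Y Γ = Branching [ ⟪ π ∧l ⟫ ] [ ⟪ π ∧l ⟫ ] [ ⟪ π ⟫ ] X X Γ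
  Rule (π ∧r) X Y Γ = Branching [ ⟪ π ∧r ⟫ ] [ ⟪ π ∧r ⟫ ] [ ⟪ π ⟫ ] X X Γ
  Rule (π ∨l) X Y Γ = Branching [ ⟪ π ∨l ⟫ ] [ ⟪ π ∨r ⟫ ] [ ⟪ π ⟫ ] X Y Γ
  Rule (π ∨r) X Y Γ = ⊥
  Rule (π □)  X Y Γ = ⊥
  Rule (π ◇)  X Y Γ = Modal [ ⟪ π ◇ ⟫ ] ⟪ π ⟫ X Γ ⊎ Modal [] ⟪ π ⟫ X Γ

  rule? : ∀ {F} (π : Path F) X Y Γ → Dec (Rule π X Y Γ)
  rule? εG     X Y Γ = no λ ()
  rule? εH     X Y Γ = branching? _ _ _ X X Γ
  rule? (π ∧l) X Y Γ = branching? _ _ _ X X Γ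
  rule? (π ∧r) X Y Γ = branching? _ _ _ X X Γ
  rule? (π ∨l) X Y Γ = branching? _ _ _ X Y Γ
  rule? (π ∨r) X Y Γ = no λ ()
  rule? (π □)  X Y Γ = no λ ()
  rule? (π ◇)  X Y Γ = modal? _ _ X Γ ⊎-dec modal? _ _ X Γ

  -- The formulae are compared through their codes, as in the program. No test for atoms is made: if
  -- `G` and `H` are in NNF, then any negated formula on a path is the negation of an atom.
  AxiomPair : Sequent → Π → Π → Set
  AxiomPair Γ x y =
    encodeFormula (proj₁ y) ≡ encodeFormula (∼ proj₁ x) ×
    Covered (x ∷ y ∷ []) Γ [] [] × Covered Γ [ x ] [ y ] []

  axiom-pair? : ∀ Γ x y → Dec (AxiomPair Γ x y)
  axiom-pair? Γ x y =
    encodeFormula (proj₁ y) ≟ᵀ encodeFormula (∼ proj₁ x) ×-dec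
    covered? (x ∷ y ∷ []) Γ [] [] ×-dec covered? Γ [ x ] [ y ] []

  Axiom : Sequent → Set
  Axiom Γ = Any (λ x → Any (AxiomPair Γ x) paths) paths

  axiom? : ∀ Γ → Dec (Axiom Γ)
  axiom? Γ = Any.any? (λ x → Any.any? (axiom-pair? Γ x) paths) paths

  Step : List Sequent → Sequent → Set
  Step S Γ = Axiom Γ ⊎ Any (λ (_ , π) → Any (λ X → Any (λ Y → Rule π X Y Γ) S) S) paths

  step? : ∀ S Γ → Dec (Step S Γ)
  step? S Γ =
    axiom? Γ ⊎-dec
    Any.any? (λ (_ , π) → Any.any? (λ X → Any.any? (λ Y → rule? π X Y Γ) S) S) paths

  step-mono : ∀ {S T Γ} → S ⊆ T → Step S Γ → Step T Γ
  step-mono S⊆T =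
    Sum.map₂ (Any.map (Any-resp-⊆ S⊆T ∘ Any.map (Any-resp-⊆ S⊆T)))

  universe : List Sequent
  universe = subsequences paths

  open Saturation step? step-mono universe
    using (stage; saturation; ∈-saturation⁺; stage-induction) public

  rule-sound : ∀ {F} (π : Path F) {X Y Γ} → Rule π X Y Γ →
               Derivable X → Derivable Y → Derivable Γ
  rule-sound εH r d _ = let Γ′ , X≈ , Γ≈ = linear⁻ r in
    infer (ax-rule Γ′ (Derivable-resp-≈ X≈ d)) Γ≈
  rule-sound (π ∧l) r d _ = let Γ′ , X≈ , Γ≈ = linear⁻ r in
    infer (∧l-rule π Γ′ (Derivable-resp-≈ X≈ d)) Γ≈
  rule-sound (π ∧r) r d _ = let Γ′ , X≈ , Γ≈ = linear⁻ r in
    infer (∧r-rule π Γ′ (Derivable-resp-≈ X≈ d)) Γ≈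
  rule-sound (π ∨l) r d e = let Γₗ , Γᵣ , X≈ , Y≈ , Γ≈ = branching⁻ r in
    infer (∨-rule π Γₗ Γᵣ (Derivable-resp-≈ X≈ d) (Derivable-resp-≈ Y≈ e)) Γ≈
  rule-sound (π ◇) (inj₁ r) d _ = let X≈ , Γ≈ = modal⁻ r in
    infer (◇-rule π _ (Derivable-resp-≈ X≈ d)) Γ≈
  rule-sound (π ◇) (inj₂ r) d _ = let X≈ , Γ≈ = modal⁻ r in
    infer (◇⁺-rule π _ (Derivable-resp-≈ X≈ d)) Γ≈

  -- Filtering the list of all paths yields one of its subsequences, so this representative lies in
  -- `universe`, whatever the order and repetitions in `Γ`.
  canonical : Sequent → Sequent
  canonical Γ = filter (_∈? Γ) paths

  canonical-≈ : ∀ Γ → Γ ≈ canonical Γ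
  canonical-≈ Γ =
    ⊆-antisym (λ {(_ , π)} → ∈-filter⁺ (_∈? Γ) (∈-paths π)) (proj₂ ∘ ∈-filter⁻ (_∈? Γ) {xs = paths})

  InSaturation : Pred Sequent 0ℓ
  InSaturation Γ = Any (Γ ≈_) saturation

  saturate : ∀ {Γ} → Step saturation (canonical Γ) → InSaturation Γ
  saturate {Γ} s =
    Any.map (λ { refl {x} → canonical-≈ Γ {x} })
            (∈-saturation⁺ (filter-∈-subsequences (_∈? Γ) paths) s)

  -- The premises are found in the saturation only up to `≈`, and the candidate tested is
  -- `canonical Γ`. Hence the rule is required of all lists with the same members. A rule with one
  -- premise passes it twice.
  rule-complete : ∀ {F} (π : Path F) {X Y Γ Δ} → Γ ≈ Δ →
                  (∀ {X′ Y′ Γ′} → X ≈ X′ → Y ≈ Y′ → Δ ≈ Γ′ → Rule π X′ Y′ Γ′) →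
                  InSaturation X → InSaturation Y → InSaturation Γ
  rule-complete π {Γ = Γ} Γ≈Δ rule x y = saturate (inj₂ (Any.map (λ { refl →
    Any.map (λ X≈ → Any.map (λ Y≈ →
      rule (λ {z} → X≈ {z}) (λ {z} → Y≈ {z}) (≈-trans (≈-sym Γ≈Δ) (canonical-≈ Γ))) y) x })
    (∈-paths π)))

  complete : ∀ {Γ} → Derivable Γ → InSaturation Γ
  complete {Γ} (axiom (p , π₁ , π₂ , Γ≈)) =
    saturate (inj₁ (Any.map (λ { refl → Any.map (λ { refl →
      refl , Covered₁⁺ (≈⇒⊇ Γ′≈) , Covered₂⁺ (≈⇒⊆ Γ′≈) }) (∈-paths π₂) }) (∈-paths π₁)))
    where
    Γ′≈ = ≈-trans (≈-sym (canonical-≈ Γ)) Γ≈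
  complete (infer (∨-rule π Γₗ Γᵣ l r) Γ≈) = rule-complete (π ∨l) Γ≈
    (λ X≈ Y≈ Δ≈ → branching⁺ (≈-sym X≈) (≈-sym Y≈) (≈-sym Δ≈)) (complete l) (complete r)
  complete (infer (∧l-rule π Γ′ d) Γ≈) = rule-complete (π ∧l) Γ≈
    (λ X≈ _ Δ≈ → linear⁺ (≈-sym X≈) (≈-sym Δ≈)) (complete d) (complete d)
  complete (infer (∧r-rule π Γ′ d) Γ≈) = rule-complete (π ∧r) Γ≈
    (λ X≈ _ Δ≈ → linear⁺ (≈-sym X≈) (≈-sym Δ≈)) (complete d) (complete d)
  complete (infer (◇-rule π Γ′ d) Γ≈) = rule-complete (π ◇) Γ≈
    (λ X≈ _ Δ≈ → inj₁ (modal⁺ Γ′ (λ { _ (here ()) }) (≈-sym X≈) (≈-sym Δ≈))) (complete d) (complete d)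
  complete (infer (◇⁺-rule π Γ′ d) Γ≈) = rule-complete (π ◇) Γ≈
    (λ X≈ _ Δ≈ → inj₂ (modal⁺ Γ′ (λ _ ()) (≈-sym X≈) (≈-sym Δ≈))) (complete d) (complete d)
  complete (infer (ax-rule Γ′ d) Γ≈) = rule-complete εH Γ≈
    (λ X≈ _ Δ≈ → linear⁺ (≈-sym X≈) (≈-sym Δ≈)) (complete d) (complete d)

  module _ (g : NNF G) (h : NNF H) where

    axiom-sound : ∀ {Γ} → Axiom Γ → Derivable Γ
    axiom-sound a with Any.satisfied a
    ... | (F₁ , π₁) , b with Any.satisfied b
    ...   | (F₂ , π₂) , eq , c₁ , c₂
      with refl ← encodeFormula-injective F₂ (∼ F₁) eq
      with neg ← NNF-path g h π₂ =
      axiom (_ , π₁ , π₂ , ⊆-antisym (Covered₂⁻ c₂) (Covered₁⁻ c₁))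

    step-sound : ∀ {S Γ} → All Derivable S → Step S Γ → Derivable Γ
    step-sound ds (inj₁ a) = axiom-sound a
    step-sound ds (inj₂ r) with Any.satisfied r
    ... | (_ , π) , r′ with All.lookupAny ds r′
    ...   | d , r″ with All.lookupAny ds r″
    ...     | e , r‴ = rule-sound π r‴ d e

    saturation-sound : All Derivable saturation
    saturation-sound = stage-induction Derivable step-sound universe

    InSaturation⇔Derivable : ∀ {Γ} → InSaturation Γ ⇔ Derivable Γ
    InSaturation⇔Derivable = mk⇔
      (λ x → let d , Γ≈ = All.lookupAny saturation-sound x in
             Derivable-resp-≈ (≈-sym λ {z} → Γ≈ {z}) d)
      complete

    saturation-enumerates : _Enumerates-𝒮₀⊢ax G H saturation
    saturation-enumerates Γ = mk⇔
      (from InSaturation⇔Derivable ∘ 𝒮₀⊢ax⇒Derivable)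
      (Derivable⇒𝒮₀⊢ax ∘ to InSaturation⇔Derivable)

-- Kripke semantics

module Semantics (G H : Formula) where
  open Calculus G H
  open Paths G H
  open Derivations G H

  module _ (ℳ : Model) (global : ∀ w → ℳ , w ⊨ H) where
    open Model ℳ

    infix 4 _⊨ₛ_

    _⊨ₛ_ : W → Sequent → Set
    w ⊨ₛ Γ = ∀ {F} {π : Path F} → ⟪ π ⟫ ∈ Γ → ℳ , w ⊨ F

    ⊨ₛ-∷ : ∀ {w F} {π : Path F} {Γ} → ℳ , w ⊨ F → w ⊨ₛ Γ → w ⊨ₛ ⟪ π ⟫ ∷ Γ
    ⊨ₛ-∷ f γ (here refl) = f
    ⊨ₛ-∷ f γ (there ∈Γ)  = γ ∈Γ

    ⊨ₛ-successor : ∀ {w v} Γ → R w v → w ⊨ₛ forget Γ → v ⊨ₛ Γ ·□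
    ⊨ₛ-successor Γ wRv γ ∈Γ□ with ∈-map⁻ _ ∈Γ□
    ... | _ , ∈Γ , refl = γ (∈-map⁺ _ ∈Γ) _ wRv

    derivable-unsatisfiable : ∀ {Γ} → Derivable Γ → ∀ {w} → ¬ (w ⊨ₛ Γ)
    derivable-unsatisfiable (axiom (p , π₁ , π₂ , Γ≈)) γ =
      γ (≈⇒⊇ Γ≈ (there (here refl))) (γ (≈⇒⊇ Γ≈ (here refl)))
    derivable-unsatisfiable (infer (∨-rule π Γₗ Γᵣ l r) Γ≈) γ with γ (≈⇒⊇ Γ≈ (here refl))
    ... | inj₁ f = derivable-unsatisfiable l (⊨ₛ-∷ f (γ ∘ ≈⇒⊇ Γ≈ ∘ there ∘ ∈-++⁺ˡ))
    ... | inj₂ f = derivable-unsatisfiable r (⊨ₛ-∷ f (γ ∘ ≈⇒⊇ Γ≈ ∘ there ∘ ∈-++⁺ʳ Γₗ))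
    derivable-unsatisfiable (infer (∧l-rule π Γ d) Γ≈) γ =
      derivable-unsatisfiable d (⊨ₛ-∷ (proj₁ (γ (≈⇒⊇ Γ≈ (here refl)))) (γ ∘ ≈⇒⊇ Γ≈ ∘ there))
    derivable-unsatisfiable (infer (∧r-rule π Γ d) Γ≈) γ =
      derivable-unsatisfiable d (⊨ₛ-∷ (proj₂ (γ (≈⇒⊇ Γ≈ (here refl)))) (γ ∘ ≈⇒⊇ Γ≈ ∘ there))
    derivable-unsatisfiable (infer (◇-rule π Γ d) Γ≈) γ =
      let _ , wRv , f = γ (≈⇒⊇ Γ≈ (here refl)) in
      derivable-unsatisfiable d (⊨ₛ-∷ f (⊨ₛ-successor Γ wRv (γ ∘ ≈⇒⊇ Γ≈ ∘ there)))
    -- Of the ◇-formula only the existence of a successor is used: the formulae below the boxes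
    -- already clash there.
    derivable-unsatisfiable (infer (◇⁺-rule π Γ d) Γ≈) γ =
      let _ , wRv , _ = γ (≈⇒⊇ Γ≈ (here refl)) in
      derivable-unsatisfiable d (⊨ₛ-successor Γ wRv (γ ∘ ≈⇒⊇ Γ≈ ∘ there))
    derivable-unsatisfiable (infer (ax-rule Γ d) Γ≈) γ =
      derivable-unsatisfiable d (⊨ₛ-∷ (global _) (γ ∘ ≈⇒⊇ Γ≈))

  Refutation⇒⊆εG : ∀ {Γ} → Refutations Γ → Γ ⊆ [ ⟪ εG ⟫ ]
  Refutation⇒⊆εG (inj₁ Γ≈) ∈Γ with () ← ≈⇒⊆ Γ≈ ∈Γ
  Refutation⇒⊆εG (inj₂ Γ≈)    = ≈⇒⊆ Γ≈

  sound : SatisfiableWrt G H → Empty (Refutations ∩ 𝒮₀⊢ax)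
  sound (ℳ , w , g , global) Γ (refutation , d) =
    derivable-unsatisfiable ℳ global (𝒮₀⊢ax⇒Derivable d) ⊨Γ
    where
    ⊨Γ : ∀ {F} {π : Path F} → ⟪ π ⟫ ∈ Γ → ℳ , w ⊨ F
    ⊨Γ ∈Γ with here refl ← Refutation⇒⊆εG refutation ∈Γ = g

  -- The upward closure of derivability. Unlike derivability itself it is monotone, as the extension
  -- to maximal sets requires.
  Refuted : Pred Sequent 0ℓ
  Refuted Γ = ∃[ Δ ] (Δ ⊆ Γ × Derivable Δ)

  Refuted-mono : ∀ {Γ Δ} → Γ ⊆ Δ → Refuted Γ → Refuted Δ
  Refuted-mono Γ⊆Δ (Θ , Θ⊆Γ , d) = Θ , Γ⊆Δ ∘ Θ⊆Γ , d

  -- A rule wants its principal path present in the premise. Either the derivable subset contains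
  -- it, and the rest is the context; or that subset already lies in `Γ`.
  extract : ∀ x {Γ} → Refuted (x ∷ Γ) →
            Refuted Γ ⊎ ∃[ Δ ] (Δ ⊆ Γ × Derivable (x ∷ Δ))
  extract x {Γ} (Δ , Δ⊆ , d) with x ∈? Δ
  ... | no x∉Δ  = inj₁ (Δ , ⊆∷∧∉⇒⊆ Δ⊆ x∉Δ , d)
  ... | yes x∈Δ =
    inj₂ (Δ ∩′ Γ , ∩′-⊆ʳ Δ Γ , Derivable-resp-≈ (⊆-antisym fwd bwd) d)
    where
    fwd : Δ ⊆ x ∷ Δ ∩′ Γ
    fwd y∈Δ with Δ⊆ y∈Δ
    ... | here refl = here refl
    ... | there y∈Γ = there (∈-filter⁺ (_∈? Γ) y∈Δ y∈Γ)
    bwd : x ∷ Δ ∩′ Γ ⊆ Δ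
    bwd (here refl) = x∈Δ
    bwd (there y∈)  = ∩′-⊆ˡ Δ Γ y∈

  infer′ : ∀ {Γ} → Inference Derivable Γ → Derivable Γ
  infer′ i = infer i ≈-refl

  -- Brings a derivable subset of a boxed context into the shape that the modal rules demand.
  boxed-≈ : ∀ Δ {Γ} → Δ ⊆ Γ ·□ → Δ ≈ unbox Δ ·□
  boxed-≈ Δ {Γ} Δ⊆ = ⊆-antisym fwd (unbox⁻ Δ)
    where
    fwd : Δ ⊆ unbox Δ ·□
    fwd x∈Δ with _ , _ , refl ← ∈-map⁻ _ (Δ⊆ x∈Δ) = ∈-map⁺ _ (unbox⁺ Δ x∈Δ)

  forget-unbox-⊆ : ∀ Δ {Γ} → Δ ⊆ Γ ·□ → forget (unbox Δ) ⊆ forget Γ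
  forget-unbox-⊆ Δ Δ⊆ x∈ with _ , π∈ , refl ← ∈-map⁻ _ x∈
    with _ , σ∈ , refl ← ∈-map⁻ _ (Δ⊆ (unbox⁻ Δ (∈-map⁺ _ π∈))) = ∈-map⁺ _ σ∈

  ∷-cong-≈ : ∀ {x Γ Δ} → Γ ≈ Δ → x ∷ Γ ≈ x ∷ Δ
  ∷-cong-≈ Γ≈Δ = ⊆-antisym (∷⁺ʳ _ (≈⇒⊆ Γ≈Δ)) (∷⁺ʳ _ (≈⇒⊇ Γ≈Δ))

  module _ {Γ : Sequent} where

    refute-εH : Refuted (⟪ εH ⟫ ∷ Γ) → Refuted Γ
    refute-εH r with extract _ r
    ... | inj₁ r′           = r′
    ... | inj₂ (Δ , Δ⊆ , d) = Δ , Δ⊆ , infer′ (ax-rule Δ d)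

    module _ {F₁ F₂ : Formula} (π : Path (F₁ ∧ F₂)) (π∈Γ : ⟪ π ⟫ ∈ Γ) where

      refute-∧l : Refuted (⟪ π ∧l ⟫ ∷ Γ) → Refuted Γ
      refute-∧l r with extract _ r
      ... | inj₁ r′           = r′
      ... | inj₂ (Δ , Δ⊆ , d) = _ , ∈-∷⊆ π∈Γ Δ⊆ , infer′ (∧l-rule π Δ d)

      refute-∧r : Refuted (⟪ π ∧r ⟫ ∷ Γ) → Refuted Γ
      refute-∧r r with extract _ r
      ... | inj₁ r′           = r′
      ... | inj₂ (Δ , Δ⊆ , d) = _ , ∈-∷⊆ π∈Γ Δ⊆ , infer′ (∧r-rule π Δ d)

    refute-∨ : ∀ {F₁ F₂} (π : Path (F₁ ∨ F₂)) → ⟪ π ⟫ ∈ Γ →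
               Refuted (⟪ π ∨l ⟫ ∷ Γ) → Refuted (⟪ π ∨r ⟫ ∷ Γ) → Refuted Γ
    refute-∨ π π∈Γ r₁ r₂ with extract _ r₁ | extract _ r₂
    ... | inj₁ r′             | _                    = r′
    ... | inj₂ _              | inj₁ r′              = r′
    ... | inj₂ (Δₗ , Δₗ⊆ , d) | inj₂ (Δᵣ , Δᵣ⊆ , e) =
      _ , ∈-∷⊆ π∈Γ (++-lub Δₗ Δₗ⊆ Δᵣ⊆) , infer′ (∨-rule π Δₗ Δᵣ d e)

    -- The two outcomes of `extract` match the two modal rules. A derivable subset of `Γ′ ·□` alone
    -- speaks of a successor, not of the present world; (◇⁺) leads back from it.
    refute-◇ : ∀ {F} (π : Path (◇ F)) → ⟪ π ⟫ ∈ Γ →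
               (Γ′ : □-Paths) → forget Γ′ ⊆ Γ →
               Refuted (⟪ π ◇ ⟫ ∷ Γ′ ·□) → Refuted Γ
    refute-◇ π π∈Γ Γ′ Γ′⊆Γ r with extract _ r
    ... | inj₁ (Δ , Δ⊆ , d) =
      _ , ∈-∷⊆ π∈Γ (Γ′⊆Γ ∘ forget-unbox-⊆ Δ Δ⊆) ,
      infer′ (◇⁺-rule π (unbox Δ) (Derivable-resp-≈ (boxed-≈ Δ Δ⊆) d))
    ... | inj₂ (Δ , Δ⊆ , d) =
      _ , ∈-∷⊆ π∈Γ (Γ′⊆Γ ∘ forget-unbox-⊆ Δ Δ⊆) ,
      infer′ (◇-rule π (unbox Δ) (Derivable-resp-≈ (∷-cong-≈ (boxed-≈ Δ Δ⊆)) d))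

  -- Selects by the addressed formula, whereas `unbox` selects by the last step of the path and
  -- removes that step.
  boxes : Sequent → □-Paths
  boxes []              = []
  boxes ((□ F , π) ∷ Γ) = (F , π) ∷ boxes Γ
  boxes (_ ∷ Γ)         = boxes Γ

  boxes⁻ : ∀ Γ → forget (boxes Γ) ⊆ Γ
  boxes⁻ ((atom _ , _) ∷ Γ) x∈         = there (boxes⁻ Γ x∈)
  boxes⁻ ((∼ _ , _) ∷ Γ)    x∈         = there (boxes⁻ Γ x∈)
  boxes⁻ ((_ ∧ _ , _) ∷ Γ)  x∈         = there (boxes⁻ Γ x∈)
  boxes⁻ ((_ ∨ _ , _) ∷ Γ)  x∈         = there (boxes⁻ Γ x∈)
  boxes⁻ ((◇ _ , _) ∷ Γ)    x∈         = there (boxes⁻ Γ x∈)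
  boxes⁻ ((□ _ , _) ∷ Γ)    (here eq)  = here eq
  boxes⁻ ((□ _ , _) ∷ Γ)    (there x∈) = there (boxes⁻ Γ x∈)

  boxes⁺ : ∀ Γ {F} {π : Path (□ F)} → ⟪ π ⟫ ∈ Γ → (F , π) ∈ boxes Γ
  boxes⁺ (_ ∷ Γ)            (here refl) = here refl
  boxes⁺ ((atom _ , _) ∷ Γ) (there x∈)  = boxes⁺ Γ x∈
  boxes⁺ ((∼ _ , _) ∷ Γ)    (there x∈)  = boxes⁺ Γ x∈
  boxes⁺ ((_ ∧ _ , _) ∷ Γ)  (there x∈)  = boxes⁺ Γ x∈
  boxes⁺ ((_ ∨ _ , _) ∷ Γ)  (there x∈)  = boxes⁺ Γ x∈
  boxes⁺ ((◇ _ , _) ∷ Γ)    (there x∈)  = boxes⁺ Γ x∈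
  boxes⁺ ((□ _ , _) ∷ Γ)    (there x∈)  = there (boxes⁺ Γ x∈)

  -- The canonical model

  module _ (g : NNF G) (h : NNF H) where

    -- The saturation contains every derivable sequent up to `≈`, so searching it suffices. This
    -- decision stands in for excluded middle below, and at `[ ⟪ εG ⟫ ]` it is the answer of the
    -- program.
    refuted? : ∀ Γ → Dec (Refuted Γ)
    refuted? Γ = map′ sat⇒ ⇒sat (Any.any? (λ Δ → covered? Δ Γ [] []) saturation)
      where
      sat⇒ : Any (λ Δ → Covered Δ Γ [] []) saturation → Refuted Γ
      sat⇒ any = let d , c = All.lookupAny (saturation-sound g h) any in _ , Covered₁⁻ c , d
      ⇒sat : Refuted Γ → Any (λ Δ → Covered Δ Γ [] []) saturation
      ⇒sat (Δ , Δ⊆Γ , d) = Any.map (λ Δ≈ → Covered₁⁺ (Δ⊆Γ ∘ ≈⇒⊇ (λ {z} → Δ≈ {z}))) (complete d)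

    -- The worlds of the countermodel are the maximal sets of paths that
    -- include no derivable sequent.
    record World : Set where
      field
        members    : Sequent
        consistent : ¬ Refuted members
        maximal    : ∀ {F} (π : Path F) → ⟪ π ⟫ ∉ members → Refuted (⟪ π ⟫ ∷ members)

    open World

    -- Lindenbaum's construction along a finite list. A path once rejected remains refuted with
    -- every later, larger set, by `Refuted-mono`.
    extend : ∀ xs Γ → ¬ Refuted Γ →
             ∃[ Δ ] (Γ ⊆ Δ × ¬ Refuted Δ × (∀ {x} → x ∈ xs → x ∉ Δ → Refuted (x ∷ Δ)))
    extend []       Γ c = Γ , id , c , λ ()
    extend (x ∷ xs) Γ c with refuted? (x ∷ Γ)
    ... | yes r = let Δ , Γ⊆Δ , c′ , max = extend xs Γ c in
      Δ , Γ⊆Δ , c′ , λ { (here refl) _ → Refuted-mono (∷⁺ʳ x Γ⊆Δ) r ; (there x∈) → max x∈ }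
    ... | no c₀ = let Δ , Γ⊆Δ , c′ , max = extend xs (x ∷ Γ) c₀ in
      Δ , Γ⊆Δ ∘ there , c′ ,
      λ { (here refl) x∉ → contradiction (Γ⊆Δ (here refl)) x∉ ; (there x∈) → max x∈ }

    world : ∀ Γ → ¬ Refuted Γ → Σ World λ w → Γ ⊆ members w
    world Γ c = let Δ , Γ⊆Δ , c′ , max = extend paths Γ c in
      record { members = Δ ; consistent = c′ ; maximal = λ π → max (∈-paths π) } , Γ⊆Δ

    member : ∀ w {F} (π : Path F) → ¬ Refuted (⟪ π ⟫ ∷ members w) → ⟪ π ⟫ ∈ members w
    member w π c = decidable-stable (⟪ π ⟫ ∈? members w) (c ∘ maximal w π)

    -- Membership concerns paths, not formulae: `p` is true if some path to it is a member. This is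
    -- safe because the axioms pair every path to `p` with every path to `∼ p`.
    canonicalModel : Model
    canonicalModel = record
      { W = World
      ; R = λ w v → ∀ {F} (π : Path (□ F)) → ⟪ π ⟫ ∈ members w → ⟪ π □ ⟫ ∈ members v
      ; V = λ p w → Σ (Path (atom p)) λ π → ⟪ π ⟫ ∈ members w
      }

    -- The implication from membership to truth is enough because negation meets only atoms, where
    -- an axiom gives the contradiction.
    truth : ∀ {F} → NNF F → ∀ w (π : Path F) → ⟪ π ⟫ ∈ members w → canonicalModel , w ⊨ F
    truth pos w π π∈ = π , π∈
    truth neg w π π∈ (σ , σ∈) =
      consistent w (_ , ∈-∷⊆ σ∈ (∈-∷⊆ π∈ λ ()) , axiom (_ , σ , π , ≈-refl))
    truth (f₁ ∧ f₂) w π π∈ =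
      truth f₁ w (π ∧l) (member w (π ∧l) (consistent w ∘ refute-∧l π π∈)) ,
      truth f₂ w (π ∧r) (member w (π ∧r) (consistent w ∘ refute-∧r π π∈))
    truth (f₁ ∨ f₂) w π π∈ with refuted? (⟪ π ∨l ⟫ ∷ members w)
    ... | no c  = inj₁ (truth f₁ w (π ∨l) (member w (π ∨l) c))
    ... | yes r = inj₂ (truth f₂ w (π ∨r) (member w (π ∨r) (consistent w ∘ refute-∨ π π∈ r)))
    truth (□ f) w π π∈ v wRv = truth f v (π □) (wRv π π∈)
    truth (◇ f) w π π∈ =
      let v , ⊆v = world (⟪ π ◇ ⟫ ∷ boxes (members w) ·□)
                         (consistent w ∘ refute-◇ π π∈ (boxes (members w)) (boxes⁻ (members w)))
      in v , (λ σ σ∈ → ⊆v (there (∈-map⁺ _ (boxes⁺ (members w) σ∈)))) ,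
         truth f v (π ◇) (⊆v (here refl))

    εH-member : ∀ w → ⟪ εH ⟫ ∈ members w
    εH-member w = member w εH (consistent w ∘ refute-εH)

    satisfiable-from-consistent : ¬ Refuted [ ⟪ εG ⟫ ] → SatisfiableWrt G H
    satisfiable-from-consistent c = let w , ⊆w = world _ c in
      canonicalModel , w , truth g w εG (⊆w (here refl)) , λ w′ → truth h w′ εH (εH-member w′)

  -- ∅ and {εG} are exactly the subsets of {εG}. So the criterion of the algorithm says that
  -- `[ ⟪ εG ⟫ ]` is refuted.
  ⊆εG⇒Refutation : ∀ {Γ} → Γ ⊆ [ ⟪ εG ⟫ ] → Refutations Γ
  ⊆εG⇒Refutation {[]}    Γ⊆ = inj₁ ≈-refl
  ⊆εG⇒Refutation {x ∷ Γ} Γ⊆ with here refl ← Γ⊆ (here refl) =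
    inj₂ (⊆-antisym Γ⊆ (∈-∷⊆ (here refl) λ ()))

  Refuted-εG⇒ : Refuted [ ⟪ εG ⟫ ] → ∃[ Γ ] (Refutations ∩ 𝒮₀⊢ax) Γ
  Refuted-εG⇒ (Γ , Γ⊆ , d) = Γ , ⊆εG⇒Refutation Γ⊆ , Derivable⇒𝒮₀⊢ax d

  ⇒Refuted-εG : ∀ {Γ} → (Refutations ∩ 𝒮₀⊢ax) Γ → Refuted [ ⟪ εG ⟫ ]
  ⇒Refuted-εG (refutation , d) = _ , Refutation⇒⊆εG refutation , 𝒮₀⊢ax⇒Derivable d

  correctness : NNF G → NNF H → SatisfiableWrt G H ⇔ Empty (Refutations ∩ 𝒮₀⊢ax)
  correctness g h = mk⇔ sound λ empty →
    satisfiable-from-consistent g h (uncurry empty ∘ Refuted-εG⇒)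

  answer : Bool → Answer
  answer true  = not-satisfiable
  answer false = satisfiable

  answer-correct : (r : Dec (Refuted [ ⟪ εG ⟫ ])) → Answers G H (answer (does r))
  answer-correct (yes r) = hit (Refuted-εG⇒ r)
  answer-correct (no c)  = miss λ Γ → c ∘ ⇒Refuted-εG

-- The program

functions : ℕ
functions = 21

pattern equalᶠ        = zero
pattern andᶠ          = suc equalᶠ
pattern orᶠ           = suc andᶠ
pattern memberᶠ       = suc orᶠ
pattern coveredᶠ      = suc memberᶠ
pattern boxᶠ          = suc coveredᶠ
pattern unboxᶠ        = suc boxᶠ
pattern branchingᶠ    = suc unboxᶠ
pattern modalᶠ        = suc branchingᶠ
pattern ruleᶠ         = suc modalᶠ
pattern rightᶠ        = suc ruleᶠ
pattern leftᶠ         = suc rightᶠ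
pattern principalᶠ    = suc leftᶠ
pattern negativeᶠ     = suc principalᶠ
pattern positiveᶠ     = suc negativeᶠ
pattern stepᶠ         = suc positiveᶠ
pattern stageᶠ        = suc stepᶠ
pattern consEachᶠ     = suc stageᶠ
pattern subsequencesᶠ = suc consEachᶠ
pattern collectᶠ      = suc subsequencesᶠ
pattern refutedᶠ      = suc collectᶠ

arity : Fin functions → ℕ
arity equalᶠ        = 2
arity andᶠ          = 2
arity orᶠ           = 2
arity memberᶠ       = 2
arity coveredᶠ      = 4
arity boxᶠ          = 1
arity unboxᶠ        = 1
arity branchingᶠ    = 6
arity modalᶠ        = 4
arity ruleᶠ         = 4
arity rightᶠ        = 4
arity leftᶠ         = 4
arity principalᶠ    = 3
arity negativeᶠ     = 3
arity positiveᶠ     = 3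
arity stepᶠ         = 3
arity stageᶠ        = 3
arity consEachᶠ     = 3
arity subsequencesᶠ = 1
arity collectᶠ      = 3
arity refutedᶠ      = 2

Code : ℕ → Set
Code = Expr arity

module _ {n : ℕ} where

  infixr 3 _&&_
  infixr 2 _||_

  true′ : Code n
  true′ = cons nil nil

  tag′ : ℕ → Code n
  tag′ zero    = nil
  tag′ (suc k) = cons nil (tag′ k)

  [_]′ : Code n → Code n
  [ e ]′ = cons e nil

  -- Calls are by value, so both operands are always evaluated. Loops built from them never stop
  -- early, and the cost bounds count every iteration.
  _&&_ _||_ : Code n → Code n → Code n
  e₁ && e₂ = call andᶠ (e₁ ∷ e₂ ∷ [])
  e₁ || e₂ = call orᶠ (e₁ ∷ e₂ ∷ [])

  covered′ : (l m₁ m₂ m₃ : Code n) → Code n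
  covered′ l m₁ m₂ m₃ = call coveredᶠ (l ∷ m₁ ∷ m₂ ∷ m₃ ∷ [])

  -- A successful test yields `nil ∙ nil`, and matching it binds both components; hence the two
  -- extra variables in each branch.
  case′ : Fin n → Code n → List (ℕ × Code (2 + n)) → Code n
  case′ x default []             = default
  case′ x default ((k , e) ∷ es) =
    match (call equalᶠ (var x ∷ tag′ k ∷ [])) (case′ x default es) e

  -- The variables of again are head, tail, list and the parameters.  In
  -- step, the value of again comes first.
  loop : (again : Code (3 + n)) (base : Code (1 + n)) (step : Code (4 + n)) → Code (1 + n)
  loop again base step = match (var 0F) base (let′ again step)

-- A comment above a clause names the parameters, that of var 0F first.

body : ∀ f → Code (arity f)
body equalᶠ =
  match (var 0F)
    (match (var 1F) true′ nil)
    (match (var 3F) nil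
      (call equalᶠ (var 2F ∷ var 0F ∷ []) && call equalᶠ (var 3F ∷ var 1F ∷ [])))
body andᶠ = match (var 0F) nil (var 3F)
body orᶠ  = match (var 0F) (var 1F) true′
-- list, element
body memberᶠ =
  loop (call memberᶠ (var 1F ∷ var 3F ∷ []))
    nil
    (call equalᶠ (var 4F ∷ var 1F ∷ []) || var 0F)
-- Γ, Δ₁, Δ₂, Δ₃
body coveredᶠ =
  loop (call coveredᶠ (var 1F ∷ var 3F ∷ var 4F ∷ var 5F ∷ []))
    true′
    ((call memberᶠ (var 4F ∷ var 1F ∷ []) ||
      call memberᶠ (var 5F ∷ var 1F ∷ []) ||
      call memberᶠ (var 6F ∷ var 1F ∷ [])) && var 0F)
body boxᶠ =
  loop (call boxᶠ (var 1F ∷ []))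
    nil
    (cons (cons (tag′ 6) (var 1F)) (var 0F))
body unboxᶠ =
  loop (call unboxᶠ (var 1F ∷ []))
    nil
    (match (var 1F) nil
      (case′ 0F (var 2F) ((6 , cons (var 3F) (var 4F)) ∷ [])))
-- A, A′, B, X, Y, Γ
body branchingᶠ =
  covered′ (var 0F) (var 3F) nil nil && covered′ (var 3F) (var 0F) (var 5F) nil &&
  covered′ (var 1F) (var 4F) nil nil && covered′ (var 4F) (var 1F) (var 5F) nil &&
  covered′ (var 2F) (var 5F) nil nil && covered′ (var 5F) (var 2F) (var 3F) (var 4F)
-- A, b, X, Γ
body modalᶠ =
  let′ (call unboxᶠ (var 2F ∷ []))
    (covered′ (var 1F) (var 3F) nil nil &&
     covered′ (var 3F) (var 1F) (call boxᶠ (var 0F ∷ [])) nil &&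
     covered′ [ var 2F ]′ (var 4F) nil nil &&
     covered′ (var 0F) (var 4F) nil nil &&
     covered′ (var 4F) [ var 2F ]′ (var 0F) nil)
-- principal path, X, Y, Γ
body ruleᶠ =
  match (var 0F) nil
    (case′ 0F nil
      -- The labels are the tags in `encodePath` of `εH`, `∧l`, `∧r`, `∨l` and `◇`; at the other
      -- constructors `Rule` is empty.
      ( (1 , linear nil)
      ∷ (2 , linear [ var 3F ]′)
      ∷ (3 , linear [ var 3F ]′)
      ∷ (4 , call branchingᶠ ([ var 4F ]′ ∷ [ cons (tag′ 5) (var 3F) ]′ ∷ [ var 3F ]′ ∷
                              var 5F ∷ var 6F ∷ var 7F ∷ []))
      ∷ (7 , (call modalᶠ ([ var 4F ]′ ∷ var 3F ∷ var 5F ∷ var 7F ∷ []) ||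
              call modalᶠ (nil ∷ var 3F ∷ var 5F ∷ var 7F ∷ [])))
      ∷ []))
  where
  linear : Code 8 → Code 8
  linear e = call branchingᶠ ([ var 4F ]′ ∷ [ var 4F ]′ ∷ e ∷ var 5F ∷ var 5F ∷ var 7F ∷ [])
-- candidates for Y, principal path, X, Γ
body rightᶠ =
  loop (call rightᶠ (var 1F ∷ var 3F ∷ var 4F ∷ var 5F ∷ []))
    nil
    (call ruleᶠ (var 4F ∷ var 5F ∷ var 1F ∷ var 6F ∷ []) || var 0F)
-- candidates for X, candidates for Y, principal path, Γ
body leftᶠ =
  loop (call leftᶠ (var 1F ∷ var 3F ∷ var 4F ∷ var 5F ∷ []))
    nil
    (call rightᶠ (var 4F ∷ var 5F ∷ var 1F ∷ var 6F ∷ []) || var 0F)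
-- labelled paths, candidates for X and Y, Γ
body principalᶠ =
  loop (call principalᶠ (var 1F ∷ var 3F ∷ var 4F ∷ []))
    nil
    (match (var 1F) nil
      (call leftᶠ (var 6F ∷ var 6F ∷ var 0F ∷ var 7F ∷ []) || var 2F))
-- labelled paths, a labelled path, Γ
body negativeᶠ =
  loop (call negativeᶠ (var 1F ∷ var 3F ∷ var 4F ∷ []))
    nil
    (match (var 1F) nil
      (match (var 6F) nil
        (call equalᶠ (var 3F ∷ cons (tag′ 1) (var 1F) ∷ []) &&
         covered′ (cons (var 0F) [ var 2F ]′) (var 9F) nil nil &&
         covered′ (var 9F) [ var 0F ]′ [ var 2F ]′ nil || var 4F)))
-- labelled paths, labelled paths, Γ
body positiveᶠ =
  loop (call positiveᶠ (var 1F ∷ var 3F ∷ var 4F ∷ []))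
    nil
    (call negativeᶠ (var 4F ∷ var 1F ∷ var 5F ∷ []) || var 0F)
-- universe, S, labelled paths
body stepᶠ =
  loop (call stepᶠ (var 1F ∷ var 3F ∷ var 4F ∷ []))
    nil
    (match (call positiveᶠ (var 5F ∷ var 5F ∷ var 1F ∷ []) ||
            call principalᶠ (var 5F ∷ var 4F ∷ var 1F ∷ []))
      (var 0F)
      (cons (var 3F) (var 2F)))
-- counter, universe, labelled paths
body stageᶠ =
  loop (call stageᶠ (var 1F ∷ var 3F ∷ var 4F ∷ []))
    nil
    (call stepᶠ (var 4F ∷ var 0F ∷ var 5F ∷ []))
-- list of lists, element, list appended to the result
body consEachᶠ =
  loop (call consEachᶠ (var 1F ∷ var 3F ∷ var 4F ∷ []))
    (var 2F)
    (cons (cons (var 4F) (var 1F)) (var 0F))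
body subsequencesᶠ =
  loop (call subsequencesᶠ (var 1F ∷ []))
    [ nil ]′
    (match (var 1F) nil
      (call consEachᶠ (var 2F ∷ var 0F ∷ var 2F ∷ [])))
-- formula, path to it, list appended to the result
body collectᶠ =
  match (var 0F) nil
    (case′ 0F (cons (cons (var 3F) (var 2F)) (var 4F))
      -- The labels are the tags of ∧, ∨, □ and ◇ in `encodeFormula`; the arguments of `binary` and
      -- `unary` are tags of path steps.
      ( (2 , binary 2 3)
      ∷ (3 , binary 4 5)
      ∷ (4 , unary 6)
      ∷ (5 , unary 7)
      ∷ []))
  where
  binary : ℕ → ℕ → Code 7
  binary k₁ k₂ =
    match (var 3F) nil
      (cons (cons (var 7F) (var 6F))
        (call collectᶠ (var 0F ∷ cons (tag′ k₁) (var 7F) ∷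
          call collectᶠ (var 1F ∷ cons (tag′ k₂) (var 7F) ∷ var 8F ∷ []) ∷ [])))
  unary : ℕ → Code 7
  unary k =
    cons (cons (var 5F) (var 4F))
      (call collectᶠ (var 3F ∷ cons (tag′ k) (var 5F) ∷ var 6F ∷ []))
-- list of sequents, Γ
body refutedᶠ =
  loop (call refutedᶠ (var 1F ∷ var 3F ∷ []))
    nil
    (covered′ (var 1F) (var 4F) nil nil || var 0F)

program : Program 2
program = record
  { functions = functions
  ; arity     = arity
  ; body      = body
  ; main      =
      let′ (call collectᶠ (var 0F ∷ cons (tag′ 0) nil ∷
              call collectᶠ (var 1F ∷ cons (tag′ 1) nil ∷ nil ∷ []) ∷ []))
        (let′ (call subsequencesᶠ (var 0F ∷ []))
          -- The universe is both the counter and the list of candidates: as many rounds as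
          -- candidates reach the fixed point.
          (let′ (call stageᶠ (var 0F ∷ var 0F ∷ var 1F ∷ []))
            (cons (call refutedᶠ (var 0F ∷ [ cons (tag′ 0) nil ]′ ∷ [])) (var 0F))))
  }

open Evaluation program

weight  : ∀ {n} → Code n → ℕ
weights : ∀ {n m} → Vec (Code n) m → ℕ

weight (var x)         = 1
weight nil             = 1
weight (cons e₁ e₂)    = suc (weight e₁ + weight e₂)
weight (match e e₁ e₂) = suc (weight e + (weight e₁ + weight e₂))
weight (let′ e₁ e₂)    = suc (weight e₁ + weight e₂)
weight (call f es)     = suc (weights es)

weights []       = 0
weights (e ∷ es) = weight e + weights es

-- A common bound for all function bodies and the main expression. It is below 2 ^ 8, which is where
-- the 8 in the exponent of `B` comes from.
maxWeight : ℕ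
maxWeight = 200

weight-body : ∀ f → weight (body f) ≤ maxWeight
weight-body = toWitness {a? = Fin.all? λ f → weight (body f) ≤? maxWeight} _

weight-main : weight (Program.main program) ≤ maxWeight
weight-main = ≤ᵇ⇒≤ _ _ _

-- Cost bounds

module Bounded (B : ℕ) (maxWeight≤B : maxWeight ≤ B) where

  -- One factor `B` pays for the number of iterations, one for the weight of the body, and one for
  -- `suc (K ^ ℓ) ≤ B * K ^ ℓ`; they meet in `raise`.
  K : ℕ
  K = B * (B * B)

  infix 4 _⊢_⇓_≤_ _⊢_⇓_≤[_] _⊢_⇓_∣_∣_ _⊢_⇓*_∣_∣_

  record _⊢_⇓_≤_ {n} (ρ : Vec Tree n) (e : Code n) (v : Tree) (bound : ℕ) : Set where
    constructor runs
    field
      {steps} : ℕ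
      run     : ρ ⊢ e ⇓ v ⟨ steps ⟩
      steps≤  : steps ≤ bound

  record _⊢_⇓_≤[_] {n} (ρ : Vec Tree n) (e : Code n) (v : Tree) (ℓ : ℕ) : Set where
    constructor level
    field
      bounded : ρ ⊢ e ⇓ v ≤ K ^ ℓ

  -- Each node of the expression is charged 1 + K ^ ℓ steps, which covers
  -- calls of functions of level ℓ; recursive calls are charged to r.
  record _⊢_⇓_∣_∣_ {n} (ρ : Vec Tree n) (e : Code n) (v : Tree) (ℓ r : ℕ) : Set where
    constructor charged
    field
      bounded : ρ ⊢ e ⇓ v ≤ weight e * suc (K ^ ℓ) + r

  record _⊢_⇓*_∣_∣_ {n m} (ρ : Vec Tree n) (es : Vec (Code n) m) (vs : Vec Tree m) (ℓ r : ℕ) : Set where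
    constructor charged
    field
      {steps} : ℕ
      run     : ρ ⊢ es ⇓* vs ⟨ steps ⟩
      steps≤  : steps ≤ weights es * suc (K ^ ℓ) + r

  suc-charge : ∀ {s} w u r → s ≤ w * suc u + r → suc s ≤ suc w * suc u + r
  suc-charge w u r s≤ = s≤s (≤-trans s≤ (+-monoˡ-≤ r (m≤n+m (w * suc u) u)))

  +-charge : ∀ {s t} w w′ u r r′ → s ≤ w * u + r → t ≤ w′ * u + r′ →
             s + t ≤ (w + w′) * u + (r + r′)
  +-charge {s} {t} w w′ u r r′ s≤ t≤ = begin
    s + t                            ≤⟨ +-mono-≤ s≤ t≤ ⟩
    w * u + r + (w′ * u + r′)        ≡⟨ +-interchange (w * u) r (w′ * u) r′ ⟩
    w * u + w′ * u + (r + r′)        ≡⟨ cong (_+ (r + r′)) (*-distribʳ-+ u w w′) ⟨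
    (w + w′) * u + (r + r′)          ∎
    where open ≤-Reasoning

  ≤-charge : ∀ {s w w′} u r → w ≤ w′ → s ≤ w * u + r → s ≤ w′ * u + r
  ≤-charge u r w≤w′ s≤ = ≤-trans s≤ (+-monoˡ-≤ r (*-monoˡ-≤ u w≤w′))

  module _ {n : ℕ} {ρ : Vec Tree n} {ℓ : ℕ} where

    private
      u : ℕ
      u = suc (K ^ ℓ)

    varˣ : ∀ x → ρ ⊢ var x ⇓ lookup ρ x ∣ ℓ ∣ 0
    varˣ x = charged (runs (var x) (suc-charge 0 (K ^ ℓ) 0 z≤n))

    nilˣ : ρ ⊢ nil ⇓ nil ∣ ℓ ∣ 0
    nilˣ = charged (runs nil (suc-charge 0 (K ^ ℓ) 0 z≤n))

    consˣ : ∀ {e₁ e₂ v₁ v₂ r r′} → ρ ⊢ e₁ ⇓ v₁ ∣ ℓ ∣ r → ρ ⊢ e₂ ⇓ v₂ ∣ ℓ ∣ r′ →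
            ρ ⊢ cons e₁ e₂ ⇓ v₁ ∙ v₂ ∣ ℓ ∣ r + r′
    consˣ {e₁} {e₂} {r = r} {r′} (charged (runs d s≤)) (charged (runs d′ t≤)) =
      charged (runs (cons d d′)
        (suc-charge (weight e₁ + weight e₂) (K ^ ℓ) (r + r′)
          (+-charge (weight e₁) (weight e₂) u r r′ s≤ t≤)))

    match-nilˣ : ∀ {e e₁ e₂ v r r′} → ρ ⊢ e ⇓ nil ∣ ℓ ∣ r → ρ ⊢ e₁ ⇓ v ∣ ℓ ∣ r′ →
                 ρ ⊢ match e e₁ e₂ ⇓ v ∣ ℓ ∣ r + r′
    match-nilˣ {e} {e₁} {e₂} {r = r} {r′} (charged (runs d s≤)) (charged (runs d′ t≤)) =
      charged (runs (match-nil d d′)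
        (suc-charge (weight e + (weight e₁ + weight e₂)) (K ^ ℓ) (r + r′)
          (+-charge (weight e) (weight e₁ + weight e₂) u r r′ s≤
            (≤-charge u r′ (m≤m+n (weight e₁) (weight e₂)) t≤))))

    match-consˣ : ∀ {e e₁ e₂ x y v r r′} →
                  ρ ⊢ e ⇓ x ∙ y ∣ ℓ ∣ r → x ∷ y ∷ ρ ⊢ e₂ ⇓ v ∣ ℓ ∣ r′ →
                  ρ ⊢ match e e₁ e₂ ⇓ v ∣ ℓ ∣ r + r′
    match-consˣ {e} {e₁} {e₂} {r = r} {r′} (charged (runs d s≤)) (charged (runs d′ t≤)) =
      charged (runs (match-cons d d′)
        (suc-charge (weight e + (weight e₁ + weight e₂)) (K ^ ℓ) (r + r′)
          (+-charge (weight e) (weight e₁ + weight e₂) u r r′ s≤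
            (≤-charge u r′ (m≤n+m (weight e₂) (weight e₁)) t≤))))

    letˣ : ∀ {e₁ e₂ x v r r′} → ρ ⊢ e₁ ⇓ x ∣ ℓ ∣ r → x ∷ ρ ⊢ e₂ ⇓ v ∣ ℓ ∣ r′ →
           ρ ⊢ let′ e₁ e₂ ⇓ v ∣ ℓ ∣ r + r′
    letˣ {e₁} {e₂} {r = r} {r′} (charged (runs d s≤)) (charged (runs d′ t≤)) =
      charged (runs (let′ d d′)
        (suc-charge (weight e₁ + weight e₂) (K ^ ℓ) (r + r′)
          (+-charge (weight e₁) (weight e₂) u r r′ s≤ t≤)))

    []ˣ : ρ ⊢ [] ⇓* [] ∣ ℓ ∣ 0
    []ˣ = charged [] z≤n

    infixr 5 _∷ˣ_

    _∷ˣ_ : ∀ {m e v r r′} {es : Vec (Code n) m} {vs} →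
           ρ ⊢ e ⇓ v ∣ ℓ ∣ r → ρ ⊢ es ⇓* vs ∣ ℓ ∣ r′ →
           ρ ⊢ e ∷ es ⇓* v ∷ vs ∣ ℓ ∣ r + r′
    _∷ˣ_ {e = e} {r = r} {r′} {es} (charged (runs d s≤)) (charged d′ t≤) =
      charged (d ∷ d′) (+-charge (weight e) (weights es) u r r′ s≤ t≤)

    callˣ : ∀ {f es vs v r} → ρ ⊢ es ⇓* vs ∣ ℓ ∣ r → vs ⊢ body f ⇓ v ≤[ ℓ ] →
            ρ ⊢ call f es ⇓ v ∣ ℓ ∣ r
    callˣ {es = es} {r = r} (charged {s} d s≤) (level (runs {t} d′ t≤)) =
      charged (runs (call d d′) (s≤s (begin
        s + t                            ≤⟨ +-mono-≤ s≤ t≤ ⟩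
        weights es * u + r + K ^ ℓ       ≡⟨ +-comm _ (K ^ ℓ) ⟩
        K ^ ℓ + (weights es * u + r)     ≡⟨ +-assoc (K ^ ℓ) _ r ⟨
        K ^ ℓ + weights es * u + r       ∎)))
      where open ≤-Reasoning

    recallˣ : ∀ {f es vs v r t} → ρ ⊢ es ⇓* vs ∣ ℓ ∣ r → vs ⊢ body f ⇓ v ≤ t →
              ρ ⊢ call f es ⇓ v ∣ ℓ ∣ r + t
    recallˣ {es = es} {r = r} {t} (charged {s} d s≤) (runs {t′} d′ t≤) =
      charged (runs (call d d′) (suc-charge (weights es) (K ^ ℓ) (r + t) (begin
        s + t′                     ≤⟨ +-mono-≤ s≤ t≤ ⟩
        weights es * u + r + t     ≡⟨ +-assoc (weights es * u) r t ⟩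
        weights es * u + (r + t)   ∎)))
      where open ≤-Reasoning

    tagˣ : ∀ k → ρ ⊢ tag′ k ⇓ tag k ∣ ℓ ∣ 0
    tagˣ zero    = nilˣ
    tagˣ (suc k) = consˣ nilˣ (tagˣ k)

  module _ {n : ℕ} {ρ : Vec Tree n} {e : Code n} {v : Tree} {ℓ : ℕ} where

    private
      u : ℕ
      u = weight e * suc (K ^ ℓ)

    -- Tree recursions are counted in units `u`, the price of one evaluation of the body without its
    -- recursive calls. The three lemmas add up the units for bodies with no, one and two recursive
    -- calls.
    settle₀ : ∀ k → ρ ⊢ e ⇓ v ∣ ℓ ∣ 0 → ρ ⊢ e ⇓ v ≤ suc k * u
    settle₀ k (charged (runs d s≤)) = runs d (≤-trans s≤ (+-monoʳ-≤ u z≤n))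

    settle₁ : ∀ k → ρ ⊢ e ⇓ v ∣ ℓ ∣ k * u → ρ ⊢ e ⇓ v ≤ suc k * u
    settle₁ k (charged d) = d

    settle₂ : ∀ k₁ k₂ → ρ ⊢ e ⇓ v ∣ ℓ ∣ k₂ * u + 0 + k₁ * u → ρ ⊢ e ⇓ v ≤ suc (k₁ + k₂) * u
    settle₂ k₁ k₂ (charged (runs d s≤)) =
      runs d (≤-trans s≤ (≤-reflexive (cong (u +_) (begin
        k₂ * u + 0 + k₁ * u   ≡⟨ cong (_+ k₁ * u) (+-identityʳ _) ⟩
        k₂ * u + k₁ * u       ≡⟨ +-comm (k₂ * u) _ ⟩
        k₁ * u + k₂ * u       ≡⟨ *-distribʳ-+ u k₁ k₂ ⟨
        (k₁ + k₂) * u         ∎))))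
      where open ≡-Reasoning

  1≤B : 1 ≤ B
  1≤B = ≤-trans (s≤s z≤n) maxWeight≤B

  0<K^ : ∀ ℓ → 0 < K ^ ℓ
  0<K^ = m^n>0 K {{>-nonZero (*-mono-≤ 1≤B (*-mono-≤ 1≤B 1≤B))}}

  raise : ∀ {w k} ℓ → k ≤ B → w ≤ maxWeight → k * (w * suc (K ^ ℓ)) ≤ K ^ suc ℓ
  raise {w} {k} ℓ k≤B w≤ = begin
    k * (w * suc (K ^ ℓ))       ≤⟨ *-mono-≤ k≤B (*-mono-≤ {w} (≤-trans w≤ maxWeight≤B) suc≤) ⟩
    B * (B * (B * K ^ ℓ))       ≡⟨ cong (B *_) (*-assoc B B _) ⟨
      B * (B * B * K ^ ℓ)         ≡⟨ *-assoc B (B * B) _ ⟨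
    B * (B * B) * K ^ ℓ         ∎
    where
    open ≤-Reasoning
    suc≤ : suc (K ^ ℓ) ≤ B * K ^ ℓ
    suc≤ = begin
      1 + K ^ ℓ          ≤⟨ +-monoˡ-≤ (K ^ ℓ) (0<K^ ℓ) ⟩
      K ^ ℓ + K ^ ℓ      ≡⟨ cong (K ^ ℓ +_) (+-identityʳ _) ⟨
      2 * K ^ ℓ          ≤⟨ *-monoˡ-≤ (K ^ ℓ) (≤-trans (s≤s (s≤s z≤n)) maxWeight≤B) ⟩
      B * K ^ ℓ          ∎

  raise-run : ∀ {n} {ρ : Vec Tree n} {e v} ℓ k → k ≤ B → weight e ≤ maxWeight →
              ρ ⊢ e ⇓ v ≤ k * (weight e * suc (K ^ ℓ)) → ρ ⊢ e ⇓ v ≤[ suc ℓ ]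
  raise-run ℓ k k≤B w≤ (runs d s≤) = level (runs d (≤-trans s≤ (raise ℓ k≤B w≤)))

  straight : ∀ {n} {ρ : Vec Tree n} {e v ℓ} → weight e ≤ maxWeight →
             ρ ⊢ e ⇓ v ∣ ℓ ∣ 0 → ρ ⊢ e ⇓ v ≤[ suc ℓ ]
  straight {ℓ = ℓ} w≤ (charged (runs d s≤)) = raise-run ℓ 1 1≤B w≤ (runs d s≤)

  Short : ∀ {A : Set} → List A → Set
  Short xs = length xs < B

  -- `Q` is an invariant of the remaining list. The recursive call is assumed at an arbitrary cost
  -- `t` and passed on as remainder, while base and step leave none; so a list of n entries costs n
  -- + 1 times the charge of the body.
  module _
    {n ℓ : ℕ} {ρ : Vec Tree n}
    {again : Code (3 + n)} {base : Code (1 + n)} {step : Code (4 + n)}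
    {A : Set} {encode : A → Tree}
    (w≤ : weight (loop again base step) ≤ maxWeight)
    (result : List A → Tree)
    (Q : List A → Set) (shrink : ∀ {x xs} → Q (x ∷ xs) → Q xs)
    (again-runs : ∀ {h l r v t} → r ∷ ρ ⊢ loop again base step ⇓ v ≤ t → h ∷ r ∷ l ∷ ρ ⊢ again ⇓ v ∣ ℓ ∣ t)
    (base-runs : nil ∷ ρ ⊢ base ⇓ result [] ∣ ℓ ∣ 0)
    (step-runs : ∀ x xs → Q (x ∷ xs) →
      result xs ∷ encode x ∷ encodeList encode xs ∷ encodeList encode (x ∷ xs) ∷ ρ ⊢
      step ⇓ result (x ∷ xs) ∣ ℓ ∣ 0)
    where

    private
      e : Code (suc n)
      e = loop again base step

      u : ℕ
      u = weight e * suc (K ^ ℓ)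

      iterations : ∀ xs → Q xs → encodeList encode xs ∷ ρ ⊢ e ⇓ result xs ≤ suc (length xs) * u
      iterations [] q with charged d ← match-nilˣ {e₂ = let′ again step} (varˣ 0F) base-runs = d
      iterations (x ∷ xs) q
        with charged (runs d s≤) ← match-consˣ {e₁ = base} (varˣ 0F)
               (letˣ (again-runs (iterations xs (shrink q))) (step-runs x xs q)) =
        runs d (≤-trans s≤ (≤-reflexive (cong (u +_) (+-identityʳ _))))

    loop-runs : ∀ xs → Q xs → Short xs → encodeList encode xs ∷ ρ ⊢ e ⇓ result xs ≤[ suc ℓ ]
    loop-runs xs q short = raise-run ℓ (suc (length xs)) short w≤ (iterations xs q)

  -- Chosen to agree with `encodeAnswer`, where true stands for `not-satisfiable`.
  bool : Bool → Tree
  bool false = nil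
  bool true  = nil ∙ nil

  true-runs : ∀ {n ℓ} {ρ : Vec Tree n} → ρ ⊢ true′ ⇓ bool true ∣ ℓ ∣ 0
  true-runs = consˣ nilˣ nilˣ

  and-runs : ∀ {ℓ} a b → bool a ∷ bool b ∷ [] ⊢ body andᶠ ⇓ bool (a Bool.∧ b) ≤[ suc ℓ ]
  and-runs false b = straight (weight-body andᶠ) (match-nilˣ (varˣ 0F) nilˣ)
  and-runs true  b = straight (weight-body andᶠ) (match-consˣ (varˣ 0F) (varˣ 3F))

  or-runs : ∀ {ℓ} a b → bool a ∷ bool b ∷ [] ⊢ body orᶠ ⇓ bool (a Bool.∨ b) ≤[ suc ℓ ]
  or-runs false b = straight (weight-body orᶠ) (match-nilˣ (varˣ 0F) (varˣ 1F))
  or-runs true  b = straight (weight-body orᶠ) (match-consˣ (varˣ 0F) true-runs)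

  module _ {n : ℕ} {ρ : Vec Tree n} {ℓ : ℕ} where

    infixr 3 _&&ˣ_
    infixr 2 _||ˣ_

    _&&ˣ_ : ∀ {e₁ e₂ a b r r′} → ρ ⊢ e₁ ⇓ bool a ∣ suc ℓ ∣ r → ρ ⊢ e₂ ⇓ bool b ∣ suc ℓ ∣ r′ →
            ρ ⊢ e₁ && e₂ ⇓ bool (a Bool.∧ b) ∣ suc ℓ ∣ r + (r′ + 0)
    d₁ &&ˣ d₂ = callˣ (d₁ ∷ˣ d₂ ∷ˣ []ˣ) (and-runs _ _)

    _||ˣ_ : ∀ {e₁ e₂ a b r r′} → ρ ⊢ e₁ ⇓ bool a ∣ suc ℓ ∣ r → ρ ⊢ e₂ ⇓ bool b ∣ suc ℓ ∣ r′ →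
            ρ ⊢ e₁ || e₂ ⇓ bool (a Bool.∨ b) ∣ suc ℓ ∣ r + (r′ + 0)
    d₁ ||ˣ d₂ = callˣ (d₁ ∷ˣ d₂ ∷ˣ []ˣ) (or-runs _ _)

  -- The recursion descends both trees in parallel and stops at a leaf of either, so the nodes of
  -- the first tree alone bound the number of calls.
  equal-steps : ∀ {ℓ} t u →
    t ∷ u ∷ [] ⊢ body equalᶠ ⇓ bool (does (t ≟ᵀ u)) ≤
    nodes t * (weight (body equalᶠ) * suc (K ^ suc ℓ))
  equal-steps {ℓ} nil nil = settle₀ {ℓ = suc ℓ} 0
    (match-nilˣ (varˣ 0F) (match-nilˣ (varˣ 1F) true-runs))
  equal-steps {ℓ} nil (u₁ ∙ u₂) = settle₀ {ℓ = suc ℓ} 0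
    (match-nilˣ (varˣ 0F) (match-consˣ (varˣ 1F) nilˣ))
  equal-steps {ℓ} (t₁ ∙ t₂) nil = settle₀ {ℓ = suc ℓ} (nodes t₁ + nodes t₂)
    (match-consˣ (varˣ 0F) (match-nilˣ (varˣ 3F) nilˣ))
  equal-steps {ℓ} (t₁ ∙ t₂) (u₁ ∙ u₂)
    with charged (runs d s≤) ← ((t₁ ∙ t₂) ∷ (u₁ ∙ u₂) ∷ [] ⊢ body equalᶠ ⇓ _ ∣ suc ℓ ∣ _) ∋
           match-consˣ (varˣ 0F) (match-consˣ (varˣ 3F)
             (recallˣ (varˣ 2F ∷ˣ varˣ 0F ∷ˣ []ˣ) (equal-steps {ℓ} t₁ u₁) &&ˣ
              recallˣ (varˣ 3F ∷ˣ varˣ 1F ∷ˣ []ˣ) (equal-steps {ℓ} t₂ u₂))) =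
    runs d (≤-trans s≤ (≤-reflexive (cong (w +_) (begin
      nodes t₁ * w + (nodes t₂ * w + 0)   ≡⟨ cong (nodes t₁ * w +_) (+-identityʳ _) ⟩
      nodes t₁ * w + nodes t₂ * w         ≡⟨ *-distribʳ-+ w (nodes t₁) (nodes t₂) ⟨
      (nodes t₁ + nodes t₂) * w           ∎))))
    where
    open ≡-Reasoning
    w = weight (body equalᶠ) * suc (K ^ suc ℓ)

  equal-runs : ∀ {ℓ} t u → nodes t ≤ B →
               t ∷ u ∷ [] ⊢ body equalᶠ ⇓ bool (does (t ≟ᵀ u)) ≤[ 2 + ℓ ]
  equal-runs {ℓ} t u t≤B = raise-run (suc ℓ) (nodes t) t≤B (weight-body equalᶠ) (equal-steps {ℓ} t u)

  module _ {n : ℕ} {ρ : Vec Tree n} {ℓ : ℕ} (x : Fin n) (k : ℕ)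
           {e₁ : Code n} {e₂ : Code (2 + n)} {small : T (nodes (lookup ρ x) ≤ᵇ maxWeight)} where

    private
      test-runs : ρ ⊢ call equalᶠ (var x ∷ tag′ k ∷ []) ⇓ bool (does (lookup ρ x ≟ᵀ tag k)) ∣ 2 + ℓ ∣ 0
      test-runs = callˣ (varˣ x ∷ˣ tagˣ k ∷ˣ []ˣ)
        (equal-runs (lookup ρ x) (tag k) (≤-trans (≤ᵇ⇒≤ _ maxWeight small) maxWeight≤B))

    missˣ : ∀ {v r} → does (lookup ρ x ≟ᵀ tag k) ≡ false →
            ρ ⊢ e₁ ⇓ v ∣ 2 + ℓ ∣ r →
            ρ ⊢ match (call equalᶠ (var x ∷ tag′ k ∷ [])) e₁ e₂ ⇓ v ∣ 2 + ℓ ∣ r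
    missˣ eq d with does (lookup ρ x ≟ᵀ tag k) | test-runs
    missˣ refl d | false | d₀ = match-nilˣ d₀ d

    hitˣ : ∀ {v r} → does (lookup ρ x ≟ᵀ tag k) ≡ true →
           nil ∷ nil ∷ ρ ⊢ e₂ ⇓ v ∣ 2 + ℓ ∣ r →
           ρ ⊢ match (call equalᶠ (var x ∷ tag′ k ∷ [])) e₁ e₂ ⇓ v ∣ 2 + ℓ ∣ r
    hitˣ eq d with does (lookup ρ x ≟ᵀ tag k) | test-runs
    hitˣ refl d | true | d₀ = match-consˣ d₀ d

-- Evaluation of the functions on encoded arguments

module Execution
  (G H : Formula) (B : ℕ) (maxWeight≤B : maxWeight ≤ B)
  (path-small : ∀ {F} (π : Calculus.Path G H F) → nodes (encodePath π) ≤ B)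
  (formula-small : ∀ {F} → Calculus.Path G H F → nodes (encodeFormula F) ≤ B)
  where

  open Calculus G H
  open Paths G H
  open Derivations G H
  open Semantics G H
  open Bounded B maxWeight≤B

  -- The code of a path does not contain the formula, which the test for axioms needs; so the
  -- program lists each path with its formula.
  encodeLabelled : Π → Tree
  encodeLabelled (F , π) = encodePath π ∙ encodeFormula F

  encodeSequents : List Sequent → Tree
  encodeSequents = encodeList encodeSequent

  constant-short : ∀ n → {T (n <ᵇ maxWeight)} → n < B
  constant-short n {lt} = ≤-trans (<ᵇ⇒< n maxWeight lt) maxWeight≤B

  member-runs : ∀ {ℓ} x Γ → Short Γ →
    encodeSequent Γ ∷ encode x ∷ [] ⊢ body memberᶠ ⇓ bool (does (x ∈? Γ)) ≤[ 3 + ℓ ]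
  member-runs x = λ Γ → loop-runs (weight-body memberᶠ)
    (λ Γ → bool (does (x ∈? Γ))) (λ _ → ⊤) _
    (λ d → recallˣ (varˣ 1F ∷ˣ varˣ 3F ∷ˣ []ˣ) d)
    nilˣ
    (λ y _ _ → callˣ (varˣ 4F ∷ˣ varˣ 1F ∷ˣ []ˣ)
                 (equal-runs (encode x) (encode y) (path-small (proj₂ x))) ||ˣ varˣ 0F)
    Γ _

  covered-runs : ∀ {ℓ} Γ Δ₁ Δ₂ Δ₃ → Short Γ → Short Δ₁ → Short Δ₂ → Short Δ₃ →
    encodeSequent Γ ∷ encodeSequent Δ₁ ∷ encodeSequent Δ₂ ∷ encodeSequent Δ₃ ∷ []
    ⊢ body coveredᶠ ⇓ bool (does (covered? Γ Δ₁ Δ₂ Δ₃)) ≤[ 4 + ℓ ]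
  covered-runs Γ Δ₁ Δ₂ Δ₃ γ δ₁ δ₂ δ₃ = loop-runs (weight-body coveredᶠ)
    (λ Γ → bool (does (covered? Γ Δ₁ Δ₂ Δ₃))) (λ _ → ⊤) _
    (λ d → recallˣ (varˣ 1F ∷ˣ varˣ 3F ∷ˣ varˣ 4F ∷ˣ varˣ 5F ∷ˣ []ˣ) d)
    true-runs
    (λ x _ _ →
      (callˣ (varˣ 4F ∷ˣ varˣ 1F ∷ˣ []ˣ) (member-runs x Δ₁ δ₁) ||ˣ
       callˣ (varˣ 5F ∷ˣ varˣ 1F ∷ˣ []ˣ) (member-runs x Δ₂ δ₂) ||ˣ
       callˣ (varˣ 6F ∷ˣ varˣ 1F ∷ˣ []ˣ) (member-runs x Δ₃ δ₃)) &&ˣ varˣ 0F)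
    Γ _ γ

  module _ {n : ℕ} {ρ : Vec Tree n} {ℓ : ℕ} where

    coveredˣ : ∀ {e e₁ e₂ e₃} Γ Δ₁ Δ₂ Δ₃ →
      ρ ⊢ e ⇓ encodeSequent Γ ∣ 4 + ℓ ∣ 0 → ρ ⊢ e₁ ⇓ encodeSequent Δ₁ ∣ 4 + ℓ ∣ 0 →
      ρ ⊢ e₂ ⇓ encodeSequent Δ₂ ∣ 4 + ℓ ∣ 0 → ρ ⊢ e₃ ⇓ encodeSequent Δ₃ ∣ 4 + ℓ ∣ 0 →
      Short Γ → Short Δ₁ → Short Δ₂ → Short Δ₃ →
      ρ ⊢ covered′ e e₁ e₂ e₃ ⇓ bool (does (covered? Γ Δ₁ Δ₂ Δ₃)) ∣ 4 + ℓ ∣ 0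
    coveredˣ Γ Δ₁ Δ₂ Δ₃ d d₁ d₂ d₃ γ δ₁ δ₂ δ₃ =
      callˣ (d ∷ˣ d₁ ∷ˣ d₂ ∷ˣ d₃ ∷ˣ []ˣ) (covered-runs Γ Δ₁ Δ₂ Δ₃ γ δ₁ δ₂ δ₃)

  encodeList-map : ∀ {A C : Set} (f : C → Tree) (g : A → C) xs →
                   encodeList f (map g xs) ≡ encodeList (f ∘ g) xs
  encodeList-map f g []       = refl
  encodeList-map f g (x ∷ xs) = cong (_ ∙_) (encodeList-map f g xs)

  box-runs : ∀ {ℓ} (Γ : □-Paths) → Short Γ →
    encodeSequent (forget Γ) ∷ [] ⊢ body boxᶠ ⇓ encodeSequent (Γ ·□) ≤[ 1 + ℓ ]
  -- Turns the argument into an encoded list of □-paths, the type over which the loop runs.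
  box-runs Γ γ rewrite encodeList-map encode (λ (_ , π) → ⟪ π ⟫) Γ =
    loop-runs (weight-body boxᶠ) (λ Γ → encodeSequent (Γ ·□)) (λ _ → ⊤) _
      (λ d → recallˣ (varˣ 1F ∷ˣ []ˣ) d)
      nilˣ
      (λ _ _ _ → consˣ (consˣ (tagˣ 6) (varˣ 1F)) (varˣ 0F))
      Γ _ γ

  unbox-runs : ∀ {ℓ} Γ → Short Γ →
    encodeSequent Γ ∷ [] ⊢ body unboxᶠ ⇓ encodeSequent (forget (unbox Γ)) ≤[ 3 + ℓ ]
  unbox-runs Γ = loop-runs (weight-body unboxᶠ) (λ Γ → encodeSequent (forget (unbox Γ)))
    (λ _ → ⊤) _
    (λ d → recallˣ (varˣ 1F ∷ˣ []ˣ) d)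
    nilˣ
    (λ { (_ , εG)   _ _ → match-consˣ (varˣ 1F) (missˣ 0F 6 refl (varˣ 2F))
       ; (_ , εH)   _ _ → match-consˣ (varˣ 1F) (missˣ 0F 6 refl (varˣ 2F))
       ; (_ , _ ∧l) _ _ → match-consˣ (varˣ 1F) (missˣ 0F 6 refl (varˣ 2F))
       ; (_ , _ ∧r) _ _ → match-consˣ (varˣ 1F) (missˣ 0F 6 refl (varˣ 2F))
       ; (_ , _ ∨l) _ _ → match-consˣ (varˣ 1F) (missˣ 0F 6 refl (varˣ 2F))
       ; (_ , _ ∨r) _ _ → match-consˣ (varˣ 1F) (missˣ 0F 6 refl (varˣ 2F))
       ; (_ , _ ◇)  _ _ → match-consˣ (varˣ 1F) (missˣ 0F 6 refl (varˣ 2F))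
       ; (_ , _ □)  _ _ → match-consˣ (varˣ 1F) (hitˣ 0F 6 refl (consˣ (varˣ 3F) (varˣ 4F))) })
    Γ _

  branching-runs : ∀ {ℓ} A A′ C X Y Γ →
    Short A → Short A′ → Short C → Short X → Short Y → Short Γ →
    encodeSequent A ∷ encodeSequent A′ ∷ encodeSequent C ∷
    encodeSequent X ∷ encodeSequent Y ∷ encodeSequent Γ ∷ []
    ⊢ body branchingᶠ ⇓ bool (does (branching? A A′ C X Y Γ)) ≤[ 5 + ℓ ]
  branching-runs A A′ C X Y Γ a a′ c x y γ = straight (weight-body branchingᶠ)
    (coveredˣ A X [] [] (varˣ 0F) (varˣ 3F) nilˣ nilˣ a x short₀ short₀ &&ˣ
     coveredˣ X A Γ [] (varˣ 3F) (varˣ 0F) (varˣ 5F) nilˣ x a γ short₀ &&ˣ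
     coveredˣ A′ Y [] [] (varˣ 1F) (varˣ 4F) nilˣ nilˣ a′ y short₀ short₀ &&ˣ
     coveredˣ Y A′ Γ [] (varˣ 4F) (varˣ 1F) (varˣ 5F) nilˣ y a′ γ short₀ &&ˣ
     coveredˣ C Γ [] [] (varˣ 2F) (varˣ 5F) nilˣ nilˣ c γ short₀ short₀ &&ˣ
     coveredˣ Γ C X Y (varˣ 5F) (varˣ 2F) (varˣ 3F) (varˣ 4F) γ c x y)
    where short₀ = constant-short 0

  map-short : ∀ {A C : Set} (f : A → C) xs → Short xs → Short (map f xs)
  map-short f xs = subst (_< B) (sym (length-map f xs))

  modal-runs : ∀ {ℓ} A {F} (π : Path (◇ F)) X Γ → Short A → Short X → Short Γ →
    encodeSequent A ∷ encodePath π ∷ encodeSequent X ∷ encodeSequent Γ ∷ []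
    ⊢ body modalᶠ ⇓ bool (does (modal? A ⟪ π ⟫ X Γ)) ≤[ 5 + ℓ ]
  modal-runs A π X Γ a x γ = straight (weight-body modalᶠ)
    (letˣ (callˣ (varˣ 2F ∷ˣ []ˣ) (unbox-runs X x))
      (coveredˣ A X [] [] (varˣ 1F) (varˣ 3F) nilˣ nilˣ a x short₀ short₀ &&ˣ
       coveredˣ X A (unbox X ·□) [] (varˣ 3F) (varˣ 1F)
         (callˣ (varˣ 0F ∷ˣ []ˣ) (box-runs (unbox X) unbox-short))
         nilˣ x a (map-short _ (unbox X) unbox-short) short₀ &&ˣ
       coveredˣ [ ⟪ π ⟫ ] Γ [] [] (consˣ (varˣ 2F) nilˣ) (varˣ 4F) nilˣ nilˣ short₁ γ short₀ short₀ &&ˣ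
       coveredˣ (forget (unbox X)) Γ [] [] (varˣ 0F) (varˣ 4F) nilˣ nilˣ forget-short γ short₀ short₀ &&ˣ
       coveredˣ Γ [ ⟪ π ⟫ ] (forget (unbox X)) [] (varˣ 4F) (consˣ (varˣ 2F) nilˣ) (varˣ 0F) nilˣ
         γ short₁ forget-short short₀))
    where
    short₀ = constant-short 0
    short₁ = constant-short 1
    unbox-short : Short (unbox X)
    unbox-short = ≤-<-trans (length-mapMaybe parent X) x
    forget-short : Short (forget (unbox X))
    forget-short = map-short _ (unbox X) unbox-short

  rule-runs : ∀ {ℓ F} (π : Path F) X Y Γ → Short X → Short Y → Short Γ →
    encodePath π ∷ encodeSequent X ∷ encodeSequent Y ∷ encodeSequent Γ ∷ []
    ⊢ body ruleᶠ ⇓ bool (does (rule? π X Y Γ)) ≤[ 6 + ℓ ]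
  rule-runs εG X Y Γ x y γ = straight (weight-body ruleᶠ) (match-consˣ (varˣ 0F)
    (missˣ 0F 1 refl (missˣ 0F 2 refl (missˣ 0F 3 refl (missˣ 0F 4 refl (missˣ 0F 7 refl nilˣ))))))
  rule-runs (π ∨r) X Y Γ x y γ = straight (weight-body ruleᶠ) (match-consˣ (varˣ 0F)
    (missˣ 0F 1 refl (missˣ 0F 2 refl (missˣ 0F 3 refl (missˣ 0F 4 refl (missˣ 0F 7 refl nilˣ))))))
  rule-runs (π □) X Y Γ x y γ = straight (weight-body ruleᶠ) (match-consˣ (varˣ 0F)
    (missˣ 0F 1 refl (missˣ 0F 2 refl (missˣ 0F 3 refl (missˣ 0F 4 refl (missˣ 0F 7 refl nilˣ))))))
  rule-runs εH X Y Γ x y γ = straight (weight-body ruleᶠ) (match-consˣ (varˣ 0F)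
    (hitˣ 0F 1 refl
      (callˣ (consˣ (varˣ 4F) nilˣ ∷ˣ consˣ (varˣ 4F) nilˣ ∷ˣ nilˣ ∷ˣ
              varˣ 5F ∷ˣ varˣ 5F ∷ˣ varˣ 7F ∷ˣ []ˣ)
             (branching-runs [ ⟪ εH ⟫ ] [ ⟪ εH ⟫ ] [] X X Γ
               (constant-short 1) (constant-short 1) (constant-short 0) x x γ))))
  rule-runs (π ∧l) X Y Γ x y γ = straight (weight-body ruleᶠ) (match-consˣ (varˣ 0F)
    (missˣ 0F 1 refl (hitˣ 0F 2 refl
      (callˣ (consˣ (varˣ 4F) nilˣ ∷ˣ consˣ (varˣ 4F) nilˣ ∷ˣ consˣ (varˣ 3F) nilˣ ∷ˣ
              varˣ 5F ∷ˣ varˣ 5F ∷ˣ varˣ 7F ∷ˣ []ˣ)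
             (branching-runs [ ⟪ π ∧l ⟫ ] [ ⟪ π ∧l ⟫ ] [ ⟪ π ⟫ ] X X Γ
               (constant-short 1) (constant-short 1) (constant-short 1) x x γ)))))
  rule-runs (π ∧r) X Y Γ x y γ = straight (weight-body ruleᶠ) (match-consˣ (varˣ 0F)
    (missˣ 0F 1 refl (missˣ 0F 2 refl (hitˣ 0F 3 refl
      (callˣ (consˣ (varˣ 4F) nilˣ ∷ˣ consˣ (varˣ 4F) nilˣ ∷ˣ consˣ (varˣ 3F) nilˣ ∷ˣ
              varˣ 5F ∷ˣ varˣ 5F ∷ˣ varˣ 7F ∷ˣ []ˣ)
             (branching-runs [ ⟪ π ∧r ⟫ ] [ ⟪ π ∧r ⟫ ] [ ⟪ π ⟫ ] X X Γ
               (constant-short 1) (constant-short 1) (constant-short 1) x x γ))))))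
  rule-runs (π ∨l) X Y Γ x y γ = straight (weight-body ruleᶠ) (match-consˣ (varˣ 0F)
    (missˣ 0F 1 refl (missˣ 0F 2 refl (missˣ 0F 3 refl (hitˣ 0F 4 refl
      (callˣ (consˣ (varˣ 4F) nilˣ ∷ˣ consˣ (consˣ (tagˣ 5) (varˣ 3F)) nilˣ ∷ˣ consˣ (varˣ 3F) nilˣ ∷ˣ
              varˣ 5F ∷ˣ varˣ 6F ∷ˣ varˣ 7F ∷ˣ []ˣ)
             (branching-runs [ ⟪ π ∨l ⟫ ] [ ⟪ π ∨r ⟫ ] [ ⟪ π ⟫ ] X Y Γ
               (constant-short 1) (constant-short 1) (constant-short 1) x y γ)))))))
  rule-runs (π ◇) X Y Γ x y γ = straight (weight-body ruleᶠ) (match-consˣ (varˣ 0F)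
    (missˣ 0F 1 refl (missˣ 0F 2 refl (missˣ 0F 3 refl (missˣ 0F 4 refl (hitˣ 0F 7 refl
      (callˣ (consˣ (varˣ 4F) nilˣ ∷ˣ varˣ 3F ∷ˣ varˣ 5F ∷ˣ varˣ 7F ∷ˣ []ˣ)
             (modal-runs [ ⟪ π ◇ ⟫ ] π X Γ (constant-short 1) x γ) ||ˣ
       callˣ (nilˣ ∷ˣ varˣ 3F ∷ˣ varˣ 5F ∷ˣ varˣ 7F ∷ˣ []ˣ)
             (modal-runs [] π X Γ (constant-short 0) x γ))))))))

  right-runs : ∀ {ℓ F} (π : Path F) X Γ S → Short X → Short Γ → All Short S → Short S →
    encodeSequents S ∷ encodePath π ∷ encodeSequent X ∷ encodeSequent Γ ∷ []
    ⊢ body rightᶠ ⇓ bool (does (Any.any? (λ Y → rule? π X Y Γ) S)) ≤[ 7 + ℓ ]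
  right-runs π X Γ S x γ = loop-runs (weight-body rightᶠ)
    (λ S → bool (does (Any.any? (λ Y → rule? π X Y Γ) S))) (All Short) All.tail
    (λ d → recallˣ (varˣ 1F ∷ˣ varˣ 3F ∷ˣ varˣ 4F ∷ˣ varˣ 5F ∷ˣ []ˣ) d)
    nilˣ
    (λ { Y _ (y ∷ _) →
      callˣ (varˣ 4F ∷ˣ varˣ 5F ∷ˣ varˣ 1F ∷ˣ varˣ 6F ∷ˣ []ˣ) (rule-runs π X Y Γ x y γ) ||ˣ varˣ 0F })
    S

  left-runs : ∀ {ℓ F} (π : Path F) Γ S T → Short Γ → All Short T → Short T → All Short S → Short S →
    encodeSequents S ∷ encodeSequents T ∷ encodePath π ∷ encodeSequent Γ ∷ []
    ⊢ body leftᶠ ⇓ bool (does (Any.any? (λ X → Any.any? (λ Y → rule? π X Y Γ) T) S)) ≤[ 8 + ℓ ]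
  left-runs π Γ S T γ ts t = loop-runs (weight-body leftᶠ)
    (λ S → bool (does (Any.any? (λ X → Any.any? (λ Y → rule? π X Y Γ) T) S))) (All Short) All.tail
    (λ d → recallˣ (varˣ 1F ∷ˣ varˣ 3F ∷ˣ varˣ 4F ∷ˣ varˣ 5F ∷ˣ []ˣ) d)
    nilˣ
    (λ { X _ (x ∷ _) →
      callˣ (varˣ 4F ∷ˣ varˣ 5F ∷ˣ varˣ 1F ∷ˣ varˣ 6F ∷ˣ []ˣ)
            (right-runs π X Γ T x γ ts t) ||ˣ varˣ 0F })
    S

  principal-runs : ∀ {ℓ} Γ S xs → Short Γ → All Short S → Short S → Short xs →
    encodeList encodeLabelled xs ∷ encodeSequents S ∷ encodeSequent Γ ∷ []
    ⊢ body principalᶠ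
    ⇓ bool (does (Any.any? (λ (_ , π) → Any.any? (λ X → Any.any? (λ Y → rule? π X Y Γ) S) S) xs))
    ≤[ 9 + ℓ ]
  principal-runs Γ S xs γ ss s = loop-runs (weight-body principalᶠ)
    (λ xs → bool (does (Any.any?
      (λ (_ , π) → Any.any? (λ X → Any.any? (λ Y → rule? π X Y Γ) S) S) xs)))
    (λ _ → ⊤) _
    (λ d → recallˣ (varˣ 1F ∷ˣ varˣ 3F ∷ˣ varˣ 4F ∷ˣ []ˣ) d)
    nilˣ
    (λ { (_ , π) _ _ → match-consˣ (varˣ 1F)
      (callˣ (varˣ 6F ∷ˣ varˣ 6F ∷ˣ varˣ 0F ∷ˣ varˣ 7F ∷ˣ []ˣ)
             (left-runs π Γ S S γ ss s ss s) ||ˣ varˣ 2F) })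
    xs _

  negative-runs : ∀ {ℓ} x Γ ys → Short Γ → Short ys →
    encodeList encodeLabelled ys ∷ encodeLabelled x ∷ encodeSequent Γ ∷ []
    ⊢ body negativeᶠ ⇓ bool (does (Any.any? (axiom-pair? Γ x) ys)) ≤[ 5 + ℓ ]
  negative-runs x Γ ys γ = loop-runs (weight-body negativeᶠ)
    (λ ys → bool (does (Any.any? (axiom-pair? Γ x) ys)))
    (λ _ → ⊤) _
    (λ d → recallˣ (varˣ 1F ∷ˣ varˣ 3F ∷ˣ varˣ 4F ∷ˣ []ˣ) d)
    nilˣ
    (λ y _ _ → match-consˣ (varˣ 1F) (match-consˣ (varˣ 6F)
      ((callˣ (varˣ 3F ∷ˣ consˣ (tagˣ 1) (varˣ 1F) ∷ˣ []ˣ)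
              (equal-runs (encodeFormula (proj₁ y)) (encodeFormula (∼ proj₁ x)) (formula-small (proj₂ y))) &&ˣ
        coveredˣ (x ∷ y ∷ []) Γ [] [] (consˣ (varˣ 0F) (consˣ (varˣ 2F) nilˣ)) (varˣ 9F) nilˣ nilˣ
          (constant-short 2) γ (constant-short 0) (constant-short 0) &&ˣ
        coveredˣ Γ [ x ] [ y ] [] (varˣ 9F) (consˣ (varˣ 0F) nilˣ) (consˣ (varˣ 2F) nilˣ) nilˣ
          γ (constant-short 1) (constant-short 1) (constant-short 0)) ||ˣ varˣ 4F)))
    ys _

  positive-runs : ∀ {ℓ} Γ xs ys → Short Γ → Short ys → Short xs →
    encodeList encodeLabelled xs ∷ encodeList encodeLabelled ys ∷ encodeSequent Γ ∷ []
    ⊢ body positiveᶠ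
    ⇓ bool (does (Any.any? (λ x → Any.any? (axiom-pair? Γ x) ys) xs)) ≤[ 6 + ℓ ]
  positive-runs Γ xs ys γ short = loop-runs (weight-body positiveᶠ)
    (λ xs → bool (does (Any.any? (λ x → Any.any? (axiom-pair? Γ x) ys) xs)))
    (λ _ → ⊤) _
    (λ d → recallˣ (varˣ 1F ∷ˣ varˣ 3F ∷ˣ varˣ 4F ∷ˣ []ˣ) d)
    nilˣ
    (λ x _ _ → callˣ (varˣ 4F ∷ˣ varˣ 1F ∷ˣ varˣ 5F ∷ˣ []ˣ) (negative-runs x Γ ys γ short) ||ˣ varˣ 0F)
    xs _

  filterˣ : ∀ {n ℓ} {ρ : Vec Tree n} {e e₁ e₂} {A : Set} {P : Pred A 0ℓ}
    (encode : A → Tree) (P? : Decidable P) x xs →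
    ρ ⊢ e ⇓ bool (does (P? x)) ∣ ℓ ∣ 0 →
    ρ ⊢ e₁ ⇓ encodeList encode (filter P? xs) ∣ ℓ ∣ 0 →
    nil ∷ nil ∷ ρ ⊢ e₂ ⇓ encode x ∙ encodeList encode (filter P? xs) ∣ ℓ ∣ 0 →
    ρ ⊢ match e e₁ e₂ ⇓ encodeList encode (filter P? (x ∷ xs)) ∣ ℓ ∣ 0
  filterˣ encode P? x xs d d₁ d₂ with does (P? x)
  ... | false = match-nilˣ d d₁
  ... | true  = match-consˣ d d₂

  module _ (paths-short : Short paths) where

    step-runs : ∀ {ℓ} S U → All Short S → Short S → All Short U → Short U →
      encodeSequents U ∷ encodeSequents S ∷ encodeList encodeLabelled paths ∷ []
      ⊢ body stepᶠ ⇓ encodeSequents (filter (step? S) U) ≤[ 10 + ℓ ]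
    step-runs S U ss s = loop-runs (weight-body stepᶠ)
      (λ U → encodeSequents (filter (step? S) U)) (All Short) All.tail
      (λ d → recallˣ (varˣ 1F ∷ˣ varˣ 3F ∷ˣ varˣ 4F ∷ˣ []ˣ) d)
      nilˣ
      (λ { Γ U (γ ∷ _) → filterˣ encodeSequent (step? S) Γ U
        (callˣ (varˣ 5F ∷ˣ varˣ 5F ∷ˣ varˣ 1F ∷ˣ []ˣ)
               (positive-runs Γ paths paths γ paths-short paths-short) ||ˣ
         callˣ (varˣ 5F ∷ˣ varˣ 4F ∷ˣ varˣ 1F ∷ˣ []ˣ)
               (principal-runs Γ S paths γ ss s paths-short))
        (varˣ 0F)
        (consˣ (varˣ 3F) (varˣ 2F)) })
      U

    module _ (universe-short : Short universe) where

      sequents-short : All Short universe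
      sequents-short =
        All.map (λ length≤ → ≤-<-trans length≤ paths-short) (subsequences-length-≤ paths)

      stage-short : ∀ c → Short (stage c)
      stage-short []      = constant-short 0
      stage-short (_ ∷ c) = ≤-<-trans (length-filter (step? (stage c)) universe) universe-short

      stage-sequents-short : ∀ c → All Short (stage c)
      stage-sequents-short []      = []
      stage-sequents-short (_ ∷ c) = All.filter⁺ (step? (stage c)) sequents-short

      stage-runs : ∀ {ℓ} c → Short c →
        encodeSequents c ∷ encodeSequents universe ∷ encodeList encodeLabelled paths ∷ []
        ⊢ body stageᶠ ⇓ encodeSequents (stage c) ≤[ 11 + ℓ ]
      stage-runs c = loop-runs (weight-body stageᶠ)
        (λ c → encodeSequents (stage c)) (λ _ → ⊤) _
        (λ d → recallˣ (varˣ 1F ∷ˣ varˣ 3F ∷ˣ varˣ 4F ∷ˣ []ˣ) d)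
        nilˣ
        (λ _ c _ → callˣ (varˣ 4F ∷ˣ varˣ 0F ∷ˣ varˣ 5F ∷ˣ []ˣ)
          (step-runs (stage c) universe (stage-sequents-short c) (stage-short c)
            sequents-short universe-short))
        c _

  consEach-runs : ∀ {ℓ} x Γs Δs → Short Γs →
    encodeSequents Γs ∷ encode x ∷ encodeSequents Δs ∷ []
    ⊢ body consEachᶠ ⇓ encodeSequents (map (x ∷_) Γs ++ Δs) ≤[ 1 + ℓ ]
  consEach-runs x Γs Δs = loop-runs (weight-body consEachᶠ)
    (λ Γs → encodeSequents (map (x ∷_) Γs ++ Δs)) (λ _ → ⊤) _
    (λ d → recallˣ (varˣ 1F ∷ˣ varˣ 3F ∷ˣ varˣ 4F ∷ˣ []ˣ) d)
    (varˣ 2F)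
    (λ _ _ _ → consˣ (consˣ (varˣ 4F) (varˣ 1F)) (varˣ 0F))
    Γs _

  -- The inner loop runs over the result for the tail, so the invariant bounds the length of the
  -- result. It is inherited because `subsequences xs` is a suffix of `subsequences (x ∷ xs)`.
  subsequences-runs : ∀ {ℓ} xs → Short (subsequences xs) → Short xs →
    encodeList encodeLabelled xs ∷ []
    ⊢ body subsequencesᶠ ⇓ encodeSequents (subsequences xs) ≤[ 2 + ℓ ]
  subsequences-runs = loop-runs (weight-body subsequencesᶠ)
    (λ xs → encodeSequents (subsequences xs)) (Short ∘ subsequences) (λ {x} {xs} → shrink {x} {xs})
    (λ d → recallˣ (varˣ 1F ∷ˣ []ˣ) d)
    (consˣ nilˣ nilˣ)
    (λ x xs q → match-consˣ (varˣ 1F)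
      (callˣ (varˣ 2F ∷ˣ varˣ 0F ∷ˣ varˣ 2F ∷ˣ []ˣ)
             (consEach-runs x (subsequences xs) (subsequences xs) (shrink {x} {xs} q))))
    where
    shrink : ∀ {x xs} → Short (subsequences (x ∷ xs)) → Short (subsequences xs)
    shrink {x} {xs} = ≤-<-trans (≤-trans
      (m≤n+m (length (subsequences xs)) (length (map (x ∷_) (subsequences xs))))
      (≤-reflexive (sym (length-++ (map (x ∷_) (subsequences xs))))))

  refuted-runs : ∀ {ℓ} Γ S → Short Γ → All Short S → Short S →
    encodeSequents S ∷ encodeSequent Γ ∷ []
    ⊢ body refutedᶠ ⇓ bool (does (Any.any? (λ Δ → covered? Δ Γ [] []) S)) ≤[ 5 + ℓ ]
  refuted-runs Γ S γ = loop-runs (weight-body refutedᶠ)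
    (λ S → bool (does (Any.any? (λ Δ → covered? Δ Γ [] []) S))) (All Short) All.tail
    (λ d → recallˣ (varˣ 1F ∷ˣ varˣ 3F ∷ˣ []ˣ) d)
    nilˣ
    (λ { Δ _ (δ ∷ _) →
      coveredˣ Δ Γ [] [] (varˣ 1F) (varˣ 4F) nilˣ nilˣ δ γ (constant-short 0) (constant-short 0)
      ||ˣ varˣ 0F })
    S

  module _ {ℓ : ℕ} where

    private
      u : ℕ
      u = weight (body collectᶠ) * suc (K ^ (2 + ℓ))

      collect-env : ∀ F → Path F → List Π → Vec Tree 3
      collect-env F π xs = encodeFormula F ∷ encodePath π ∷ encodeList encodeLabelled xs ∷ []

    collect-steps : ∀ F (π : Path F) xs →
      collect-env F π xs ⊢ body collectᶠ ⇓ encodeList encodeLabelled (collect F π xs) ≤ size F * u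
    collect-steps (atom p) π xs = settle₀ {ℓ = 2 + ℓ} (ℕᵇ.size p) (match-consˣ (varˣ 0F)
      (missˣ 0F 2 refl (missˣ 0F 3 refl (missˣ 0F 4 refl (missˣ 0F 5 refl
        (consˣ (consˣ (varˣ 3F) (varˣ 2F)) (varˣ 4F)))))))
    collect-steps (∼ F) π xs = settle₀ {ℓ = 2 + ℓ} (size F) (match-consˣ (varˣ 0F)
      (missˣ 0F 2 refl (missˣ 0F 3 refl (missˣ 0F 4 refl (missˣ 0F 5 refl
        (consˣ (consˣ (varˣ 3F) (varˣ 2F)) (varˣ 4F)))))))
    collect-steps (F₁ ∧ F₂) π xs = settle₂ {ℓ = 2 + ℓ} (size F₁) (size F₂) (match-consˣ (varˣ 0F)
      (hitˣ 0F 2 refl (match-consˣ (varˣ 3F)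
        (consˣ (consˣ (varˣ 7F) (varˣ 6F))
          (recallˣ (varˣ 0F ∷ˣ consˣ (tagˣ 2) (varˣ 7F) ∷ˣ
            recallˣ (varˣ 1F ∷ˣ consˣ (tagˣ 3) (varˣ 7F) ∷ˣ varˣ 8F ∷ˣ []ˣ)
              (collect-steps F₂ (π ∧r) xs) ∷ˣ []ˣ)
            (collect-steps F₁ (π ∧l) (collect F₂ (π ∧r) xs)))))))
    collect-steps (F₁ ∨ F₂) π xs = settle₂ {ℓ = 2 + ℓ} (size F₁) (size F₂) (match-consˣ (varˣ 0F)
      (missˣ 0F 2 refl (hitˣ 0F 3 refl (match-consˣ (varˣ 3F)
        (consˣ (consˣ (varˣ 7F) (varˣ 6F))
          (recallˣ (varˣ 0F ∷ˣ consˣ (tagˣ 4) (varˣ 7F) ∷ˣ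
            recallˣ (varˣ 1F ∷ˣ consˣ (tagˣ 5) (varˣ 7F) ∷ˣ varˣ 8F ∷ˣ []ˣ)
              (collect-steps F₂ (π ∨r) xs) ∷ˣ []ˣ)
            (collect-steps F₁ (π ∨l) (collect F₂ (π ∨r) xs))))))))
    collect-steps (□ F) π xs = settle₁ {ℓ = 2 + ℓ} (size F) (match-consˣ (varˣ 0F)
      (missˣ 0F 2 refl (missˣ 0F 3 refl (hitˣ 0F 4 refl
        (consˣ (consˣ (varˣ 5F) (varˣ 4F))
          (recallˣ (varˣ 3F ∷ˣ consˣ (tagˣ 6) (varˣ 5F) ∷ˣ varˣ 6F ∷ˣ []ˣ)
            (collect-steps F (π □) xs)))))))
    collect-steps (◇ F) π xs = settle₁ {ℓ = 2 + ℓ} (size F) (match-consˣ (varˣ 0F)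
      (missˣ 0F 2 refl (missˣ 0F 3 refl (missˣ 0F 4 refl (hitˣ 0F 5 refl
        (consˣ (consˣ (varˣ 5F) (varˣ 4F))
          (recallˣ (varˣ 3F ∷ˣ consˣ (tagˣ 7) (varˣ 5F) ∷ˣ varˣ 6F ∷ˣ []ˣ)
            (collect-steps F (π ◇) xs))))))))

    collect-runs : ∀ F (π : Path F) xs → size F ≤ B →
      collect-env F π xs ⊢ body collectᶠ ⇓ encodeList encodeLabelled (collect F π xs) ≤[ 3 + ℓ ]
    collect-runs F π xs F≤B = raise-run (2 + ℓ) (size F) F≤B (weight-body collectᶠ) (collect-steps F π xs)

  -- The level 12 counts the nesting: connectives 1, equality 2, membership 3, covering 4,
  -- `Branching` and `Modal` 5, `Rule` 6, the searches for Y, X and the principal path 7 to 9, a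
  -- round 10, all rounds 11, the main expression 12.
  main-runs : ∀ {ℓ} → Short paths → Short universe → size G ≤ B → size H ≤ B →
    encodeFormula G ∷ encodeFormula H ∷ [] ⊢ Program.main program ⇓
    bool (does (Any.any? (λ Δ → covered? Δ [ ⟪ εG ⟫ ] [] []) saturation)) ∙
    encodeSequents saturation ≤[ 12 + ℓ ]
  main-runs p u G≤B H≤B = straight weight-main
    (letˣ (callˣ (varˣ 0F ∷ˣ consˣ nilˣ nilˣ ∷ˣ
             callˣ (varˣ 1F ∷ˣ consˣ (tagˣ 1) nilˣ ∷ˣ nilˣ ∷ˣ []ˣ) (collect-runs H εH [] H≤B) ∷ˣ []ˣ)
             (collect-runs G εG (collect H εH []) G≤B))
      (letˣ (callˣ (varˣ 0F ∷ˣ []ˣ) (subsequences-runs paths u p))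
        (letˣ (callˣ (varˣ 0F ∷ˣ varˣ 0F ∷ˣ varˣ 1F ∷ˣ []ˣ) (stage-runs p u universe u))
          (consˣ (callˣ (varˣ 0F ∷ˣ consˣ (consˣ nilˣ nilˣ) nilˣ ∷ˣ []ˣ)
                   (refuted-runs [ ⟪ εG ⟫ ] saturation (constant-short 1)
                     (stage-sequents-short p u universe) (stage-short p u universe)))
                 (varˣ 0F)))))

  bool-answer : ∀ b → bool b ≡ encodeAnswer (answer b)
  bool-answer false = refl
  bool-answer true  = refl

  module _ (g : NNF G) (h : NNF H) where

    refuted : Dec (Refuted [ ⟪ εG ⟫ ])
    refuted = refuted? g h [ ⟪ εG ⟫ ]

    realized-by-run : ∀ {b} → K ^ 12 ≡ b →
      encodeFormula G ∷ encodeFormula H ∷ [] ⊢ Program.main program ⇓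
      bool (does refuted) ∙ encodeSequents saturation ≤[ 12 ] →
      RealizedBy G H program b
    realized-by-run K≡ (level (runs run steps≤)) = record
      { closure    = saturation
      ; answer     = answer (does refuted)
      ; time       = _
      ; enumerates = saturation-enumerates g h
      ; answers    = answer-correct refuted
      ; runs       = subst (λ v → Runs program _ (v ∙ encodeSequents saturation) _)
                           (bool-answer (does refuted)) run
      ; in-time    = subst (_ ≤_) K≡ steps≤
      }

    realized : Short paths → Short universe → size G ≤ B → size H ≤ B →
               ∀ {b} → K ^ 12 ≡ b → RealizedBy G H program b
    realized p u G≤B H≤B K≡ = realized-by-run K≡ (main-runs {0} p u G≤B H≤B)

-- The size of the input

n<2^n : ∀ n → n < 2 ^ n
n<2^n zero    = s≤s z≤n
n<2^n (suc n) = begin-strict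
  suc n             ≤⟨ n<2^n n ⟩
  2 ^ n             <⟨ m<m+n (2 ^ n) (≤-<-trans z≤n (n<2^n n)) ⟩
  2 ^ n + 2 ^ n     ≡⟨ cong (2 ^ n +_) (+-identityʳ _) ⟨
  2 ^ suc n         ∎
  where open ≤-Reasoning

0<size : ∀ F → 0 < size F
0<size (atom _) = z<s
0<size (∼ _)    = z<s
0<size (_ ∧ _)  = z<s
0<size (_ ∨ _)  = z<s
0<size (□ _)    = z<s
0<size (◇ _)    = z<s

nodes-tag : ∀ k → nodes (tag k) ≡ suc (2 * k)
nodes-tag zero    = refl
nodes-tag (suc k) = cong (2 +_) (trans (nodes-tag k) (sym (+-suc k (k + 0))))

-- The largest tag is 7, with 15 nodes; the pair adds one more.
nodes-tag-∙ : ∀ k {k≤7 : T (k ≤ᵇ 7)} t → nodes (tag k ∙ t) ≤ 16 + nodes t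
nodes-tag-∙ k {k≤7} t = s≤s (+-monoˡ-≤ (nodes t) (begin
  nodes (tag k)   ≡⟨ nodes-tag k ⟩
  suc (2 * k)     ≤⟨ s≤s (*-monoʳ-≤ 2 (≤ᵇ⇒≤ k 7 k≤7)) ⟩
  15              ∎))
  where open ≤-Reasoning

-- At most 17 nodes are due to one symbol, namely a tag and two pairs. Allowing 32 gives a power of
-- two, which `32s≤B` absorbs into `B`. The offset `m` is for the leaf at the end of an index.
nodes-unary : ∀ k {k≤7 : T (k ≤ᵇ 7)} t m n →
              nodes t ≤ m + 32 * n → nodes (tag k ∙ t) ≤ m + 32 * suc n
nodes-unary k {k≤7} t m n t≤ = begin
  nodes (tag k ∙ t)    ≤⟨ nodes-tag-∙ k {k≤7} t ⟩
  16 + nodes t         ≤⟨ +-mono-≤ (≤ᵇ⇒≤ 16 32 _) t≤ ⟩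
  32 + (m + 32 * n)    ≡⟨ +-comm 32 _ ⟩
  m + 32 * n + 32      ≡⟨ +-assoc m _ 32 ⟩
  m + (32 * n + 32)    ≡⟨ cong (m +_) (trans (+-comm _ 32) (sym (*-suc 32 n))) ⟩
  m + 32 * suc n       ∎
  where open ≤-Reasoning

nodes-binary : ∀ k {k≤7 : T (k ≤ᵇ 7)} t u m n →
               nodes t ≤ 32 * m → nodes u ≤ 32 * n →
               nodes (tag k ∙ t ∙ u) ≤ 32 * suc (m + n)
nodes-binary k {k≤7} t u m n t≤ u≤ = begin
  nodes (tag k ∙ t ∙ u)             ≤⟨ nodes-tag-∙ k {k≤7} (t ∙ u) ⟩
  17 + (nodes t + nodes u)          ≤⟨ +-mono-≤ (≤ᵇ⇒≤ 17 32 _) (+-mono-≤ t≤ u≤) ⟩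
  32 + (32 * m + 32 * n)            ≡⟨ cong (32 +_) (*-distribˡ-+ 32 m n) ⟨
  32 + 32 * (m + n)                 ≡⟨ *-suc 32 (m + n) ⟨
  32 * suc (m + n)                  ∎
  where open ≤-Reasoning

nodes-encodeIndex : ∀ p → nodes (encodeIndex p) ≤ 1 + 32 * ℕᵇ.size p
nodes-encodeIndex ℕᵇ.zero  = ≤-refl
nodes-encodeIndex 2[1+ p ] = nodes-unary 0 (encodeIndex p) 1 (ℕᵇ.size p) (nodes-encodeIndex p)
nodes-encodeIndex 1+[2 p ] = nodes-unary 1 (encodeIndex p) 1 (ℕᵇ.size p) (nodes-encodeIndex p)

nodes-encodeFormula : ∀ F → nodes (encodeFormula F) ≤ 32 * size F
nodes-encodeFormula (atom p) = begin
  2 + nodes (encodeIndex p)    ≤⟨ +-monoʳ-≤ 2 (nodes-encodeIndex p) ⟩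
  3 + 32 * ℕᵇ.size p           ≤⟨ +-monoˡ-≤ _ (≤ᵇ⇒≤ 3 32 _) ⟩
  32 + 32 * ℕᵇ.size p          ≡⟨ *-suc 32 _ ⟨
  32 * size (atom p)           ∎
  where open ≤-Reasoning
nodes-encodeFormula (∼ F)   = nodes-unary 1 (encodeFormula F) 0 (size F) (nodes-encodeFormula F)
nodes-encodeFormula (F ∧ G) =
  nodes-binary 2 (encodeFormula F) (encodeFormula G) (size F) (size G)
    (nodes-encodeFormula F) (nodes-encodeFormula G)
nodes-encodeFormula (F ∨ G) =
  nodes-binary 3 (encodeFormula F) (encodeFormula G) (size F) (size G)
    (nodes-encodeFormula F) (nodes-encodeFormula G)
nodes-encodeFormula (□ F)   = nodes-unary 4 (encodeFormula F) 0 (size F) (nodes-encodeFormula F)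
nodes-encodeFormula (◇ F)   = nodes-unary 5 (encodeFormula F) 0 (size F) (nodes-encodeFormula F)

-- The exponents are variables here, lest 2 ^_ be unfolded at them.
K-power : ∀ B m e → B ≡ 2 ^ m → m * 36 ≡ e → (B * (B * B)) ^ 12 ≡ 2 ^ e
K-power B m e B≡ refl = begin
  (B * (B * B)) ^ 12    ≡⟨ cong (λ n → (B * (B * n)) ^ 12) (*-identityʳ B) ⟨
  (B ^ 3) ^ 12          ≡⟨ ^-*-assoc B 3 12 ⟩
  B ^ 36                ≡⟨ cong (_^ 36) B≡ ⟩
  (2 ^ m) ^ 36          ≡⟨ ^-*-assoc 2 m 36 ⟩
  2 ^ (m * 36)          ∎
  where open ≡-Reasoning

-- The bound `K ^ 12` is `B ^ 36`, so the exponent is 36 (8 + s) = 288 + 36 s.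
bound : Polynomial
bound = 288 ∷ 36 ∷ []

exponent : ∀ s → (8 + s) * 36 ≡ eval bound s
exponent s = begin
  (8 + s) * 36                ≡⟨ *-distribʳ-+ 36 8 s ⟩
  288 + s * 36                ≡⟨ cong (λ n → 288 + s * n) (+-identityʳ 36) ⟨
  288 + s * (36 + 0)          ≡⟨ cong (λ n → 288 + s * (36 + n)) (*-zeroʳ s) ⟨
  288 + s * (36 + s * 0)      ∎
  where open ≡-Reasoning

-- The bounds in terms of the input size

module Realization
  (G H : Formula) (g : NNF G) (h : NNF H) (B : ℕ) (B≡ : B ≡ 2 ^ (8 + (size G + size H)))
  where

  open Calculus G H
  open Paths G H
  open Derivations G H
  open Semantics G H

  s : ℕ
  s = size G + size H

  nodes-child : ∀ k {k≤7 : T (k ≤ᵇ 7)} t m n → n < m →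
                nodes t + 32 * m ≤ 32 * s → nodes (tag k ∙ t) + 32 * n ≤ 32 * s
  nodes-child k {k≤7} t m n n<m t≤ = begin
    nodes (tag k ∙ t) + 32 * n    ≤⟨ +-monoˡ-≤ (32 * n) (nodes-tag-∙ k {k≤7} t) ⟩
    16 + nodes t + 32 * n         ≤⟨ +-monoˡ-≤ (32 * n) (+-monoˡ-≤ (nodes t) (≤ᵇ⇒≤ 16 32 _)) ⟩
    32 + nodes t + 32 * n         ≡⟨ cong (_+ 32 * n) (+-comm 32 (nodes t)) ⟩
    nodes t + 32 + 32 * n         ≡⟨ +-assoc (nodes t) 32 (32 * n) ⟩
    nodes t + (32 + 32 * n)       ≡⟨ cong (nodes t +_) (*-suc 32 n) ⟨
    nodes t + 32 * suc n          ≤⟨ +-monoʳ-≤ (nodes t) (*-monoʳ-≤ 32 n<m) ⟩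
    nodes t + 32 * m              ≤⟨ t≤ ⟩
    32 * s                        ∎
    where open ≤-Reasoning

  nodes-root : ∀ k m n → k ≤ 32 → 0 < n → k + 32 * m ≤ 32 * (m + n)
  nodes-root k m n k≤32 0<n = begin
    k + 32 * m          ≤⟨ +-monoˡ-≤ (32 * m) (≤-trans k≤32 (*-monoʳ-≤ 32 0<n)) ⟩
    32 * n + 32 * m     ≡⟨ *-distribˡ-+ 32 n m ⟨
    32 * (n + m)        ≡⟨ cong (32 *_) (+-comm n m) ⟩
    32 * (m + n)        ∎
    where open ≤-Reasoning

  -- A potential argument: each step adds at most 16 nodes to the code of the path and takes at
  -- least one symbol, worth 32, off the addressed formula. At a root, the other input formula pays
  -- for the code of `εG` or `εH`. The sum bounds path codes and formula codes at once.
  nodes-path : ∀ {F} (π : Path F) → nodes (encodePath π) + 32 * size F ≤ 32 * s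
  nodes-path εG = nodes-root 3 (size G) (size H) (≤ᵇ⇒≤ 3 32 _) (0<size H)
  nodes-path εH = subst (λ n → 5 + 32 * size H ≤ 32 * n) (+-comm (size H) (size G))
                        (nodes-root 5 (size H) (size G) (≤ᵇ⇒≤ 5 32 _) (0<size G))
  nodes-path (_∧l {F₁} {F₂} π) =
    nodes-child 2 (encodePath π) (size (F₁ ∧ F₂)) (size F₁) (s≤s (m≤m+n (size F₁) _)) (nodes-path π)
  nodes-path (_∧r {F₁} {F₂} π) =
    nodes-child 3 (encodePath π) (size (F₁ ∧ F₂)) (size F₂) (s≤s (m≤n+m _ (size F₁))) (nodes-path π)
  nodes-path (_∨l {F₁} {F₂} π) =
    nodes-child 4 (encodePath π) (size (F₁ ∨ F₂)) (size F₁) (s≤s (m≤m+n (size F₁) _)) (nodes-path π)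
  nodes-path (_∨r {F₁} {F₂} π) =
    nodes-child 5 (encodePath π) (size (F₁ ∨ F₂)) (size F₂) (s≤s (m≤n+m _ (size F₁))) (nodes-path π)
  nodes-path (_□ {F} π) =
    nodes-child 6 (encodePath π) (size (□ F)) (size F) ≤-refl (nodes-path π)
  nodes-path (_◇ {F} π) =
    nodes-child 7 (encodePath π) (size (◇ F)) (size F) ≤-refl (nodes-path π)

  2^≤B : ∀ {n} → n ≤ 8 + s → 2 ^ n ≤ B
  2^≤B n≤ = subst (_ ≤_) (sym B≡) (^-monoʳ-≤ 2 n≤)

  32s≤B : 32 * s ≤ B
  32s≤B = begin
    32 * s         ≤⟨ *-monoʳ-≤ 32 (<⇒≤ (n<2^n s)) ⟩
    2 ^ 5 * 2 ^ s  ≡⟨ ^-distribˡ-+-* 2 5 s ⟨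
    2 ^ (5 + s)    ≤⟨ 2^≤B (+-monoˡ-≤ s (≤ᵇ⇒≤ 5 8 _)) ⟩
    B              ∎
    where open ≤-Reasoning

  maxWeight≤B : maxWeight ≤ B
  maxWeight≤B = ≤-trans (≤ᵇ⇒≤ maxWeight (2 ^ 8) _) (2^≤B (m≤m+n 8 s))

  path-small : ∀ {F} (π : Path F) → nodes (encodePath π) ≤ B
  path-small {F} π = ≤-trans (m≤m+n _ (32 * size F)) (≤-trans (nodes-path π) 32s≤B)

  formula-small : ∀ {F} → Path F → nodes (encodeFormula F) ≤ B
  formula-small {F} π = ≤-trans (nodes-encodeFormula F)
    (≤-trans (m≤n+m (32 * size F) (nodes (encodePath π))) (≤-trans (nodes-path π) 32s≤B))

  universe-short : length universe < B
  universe-short = begin-strict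
    length universe      ≡⟨ length-subsequences paths ⟩
    2 ^ length paths     ≤⟨ ^-monoʳ-≤ 2 length-paths ⟩
    2 ^ s                <⟨ ^-monoʳ-< 2 ≤-refl {s} {suc s} ≤-refl ⟩
    2 ^ suc s            ≤⟨ 2^≤B (+-monoˡ-≤ s (≤ᵇ⇒≤ 1 8 _)) ⟩
    B                    ∎
    where open ≤-Reasoning

  ≤s⇒<B : ∀ {n} → n ≤ s → n < B
  ≤s⇒<B n≤s = ≤-<-trans n≤s (<-≤-trans (n<2^n s) (2^≤B (m≤n+m s 8)))

  realizes : ∀ e → (8 + s) * 36 ≡ e → RealizedBy G H program (2 ^ e)
  realizes e e≡ = Execution.realized G H B maxWeight≤B path-small formula-small g h
    (≤s⇒<B length-paths) universe-short
    (<⇒≤ (≤s⇒<B (m≤m+n (size G) _))) (<⇒≤ (≤s⇒<B (m≤n+m _ (size G))))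
    (K-power B (8 + s) e B≡ e≡)

open Calculus using (Refutations; 𝒮₀⊢ax)

corollary2 : (∀ G H → NNF G → NNF H →
    SatisfiableWrt G H ⇔ Empty (Refutations G H ∩ 𝒮₀⊢ax G H))
    ×
    (∃[ P ] ∃[ p ] (∀ G H → NNF G → NNF H →
    RealizedBy G H P (2 ^ eval p (size G + size H))))
corollary2 =
  (λ G H → Semantics.correctness G H) ,
  program , bound , λ G H g h →
    Realization.realizes G H g h _ refl (eval bound (size G + size H)) (exponent (size G + size H))
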